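{- As $\varepsilon\to0^+$, $$\mathcal Z_2(1-\varepsilon)=C_2-\gamma-\varepsilon\log\frac1\varepsilon+O(\varepsilon).$$
   Context: $\zeta$ is the Riemann zeta function and $\gamma$ is Euler's constant. For $|z|<1$, $$\mathcal Z_2(z):=\sum_{n=1}^{\infty}\left\{\operatorname{Li}_2\!\left(\frac zn\right)-\frac zn\right\}=\sum_{r=2}^{\infty}\frac{\zeta(r)}{r^2}z^r ,$$ where $\operatorname{Li}_2(z)=\sum_{n\ge1}z^n/n^2$, and $$C_2:=\lim_{n\to\infty}\left(\sum_{k=1}^n \operatorname{Li}_2\!\left(\frac1k\right)-\log n\right).$$ -}

module Defs where

open import Data.Nat.Base as ℕ using (ℕ; zero; suc; _!)
import Data.Nat.Properties as ℕ
open import Data.Integer.Base as ℤ using (+_)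
open import Data.Rational.Base as ℚ using (ℚ; 0ℚ; 1ℚ; ½)
import Data.Rational.Properties as ℚ
open import Data.Rational.Solver using (module +-*-Solver)
open import Data.Product using (Σ-syntax; ∃-syntax; _×_; _,_; proj₁; proj₂)
open import Data.Sum.Base using (inj₁; inj₂)
open import Relation.Binary.PropositionalEquality
  using (_≡_; refl; sym; trans; cong; cong₂; subst; subst₂; module ≡-Reasoning)

------------------------------------------------------------------------
-- Auxiliary facts about ℚ

private
  ½ε>0 : ∀ {ε} → 0ℚ ℚ.< ε → 0ℚ ℚ.< ½ ℚ.* ε
  ½ε>0 {ε} ε>0 = ℚ.positive⁻¹ (½ ℚ.* ε)
    {{ℚ.pos*pos⇒pos ½ ε {{ℚ.positive ε>0}}}}

  ½ε+½ε : ∀ ε → ½ ℚ.* ε ℚ.+ ½ ℚ.* ε ≡ ε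
  ½ε+½ε ε = trans (sym (ℚ.*-distribʳ-+ ε ½ ½)) (ℚ.*-identityˡ ε)

  -- ε / c for c > 0
  module _ (c : ℚ) (c>0 : 0ℚ ℚ.< c) where
    c⁻¹ : ℚ
    c⁻¹ = ℚ.1/_ c {{ℚ.>-nonZero c>0}}

    quot : ℚ → ℚ
    quot ε = c⁻¹ ℚ.* ε

    quot>0 : ∀ {ε} → 0ℚ ℚ.< ε → 0ℚ ℚ.< quot ε
    quot>0 {ε} ε>0 = ℚ.positive⁻¹ (c⁻¹ ℚ.* ε)
      {{ℚ.pos*pos⇒pos c⁻¹ {{ℚ.1/pos⇒pos c {{ℚ.positive c>0}}}} ε {{ℚ.positive ε>0}}}}

    *-quot : ∀ ε → c ℚ.* quot ε ≡ ε
    *-quot ε = trans (sym (ℚ.*-assoc c c⁻¹ ε))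
      (trans (cong (ℚ._* ε) (ℚ.*-inverseʳ c {{ℚ.>-nonZero c>0}})) (ℚ.*-identityˡ ε))

  *-mono-≤ : ∀ {a b c d} → 0ℚ ℚ.≤ a → 0ℚ ℚ.≤ d →
             a ℚ.≤ b → c ℚ.≤ d → a ℚ.* c ℚ.≤ b ℚ.* d
  *-mono-≤ {a} {b} {c} {d} 0≤a 0≤d a≤b c≤d = ℚ.≤-trans
    (ℚ.*-monoˡ-≤-nonNeg a {{ℚ.nonNegative 0≤a}} c≤d)
    (ℚ.*-monoʳ-≤-nonNeg d {{ℚ.nonNegative 0≤d}} a≤b)

------------------------------------------------------------------------
-- Real numbers: Cauchy sequences of rationals, with a modulus of
-- convergence (the witness N).  Equality of reals is never needed below
-- in any form other than "is the limit of".

Cauchy : (ℕ → ℚ) → Set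
Cauchy s = ∀ ε → 0ℚ ℚ.< ε →
  ∃[ N ] (∀ m n → N ℕ.≤ m → N ℕ.≤ n → ℚ.∣ s m ℚ.- s n ∣ ℚ.≤ ε)

record ℝ : Set where
  constructor mkℝ
  field
    seq    : ℕ → ℚ
    cauchy : Cauchy seq

open ℝ public

infix 4 _<_ _≤_

_<_ : ℝ → ℝ → Set
x < y = ∃[ c ] (0ℚ ℚ.< c × ∃[ N ] (∀ n → N ℕ.≤ n → seq x n ℚ.+ c ℚ.≤ seq y n))

_≤_ : ℝ → ℝ → Set
x ≤ y = ∀ ε → 0ℚ ℚ.< ε → ∃[ N ] (∀ n → N ℕ.≤ n → seq x n ℚ.≤ seq y n ℚ.+ ε)

------------------------------------------------------------------------
-- Arithmetic, termwise on representatives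

fromℚ : ℚ → ℝ
fromℚ q = mkℝ (λ _ → q) λ ε ε>0 → 0 , λ _ _ _ _ →
  subst (λ t → ℚ.∣ t ∣ ℚ.≤ ε) (sym (ℚ.+-inverseʳ q)) (ℚ.<⇒≤ ε>0)

fromℕ : ℕ → ℝ
fromℕ n = fromℚ (+ n ℚ./ 1)

0ᴿ 1ᴿ : ℝ
0ᴿ = fromℚ 0ℚ
1ᴿ = fromℚ 1ℚ

infix  8 -_
infixl 7 _*_
infixl 6 _+_ _-_
infixr 9 _^_

_+_ : ℝ → ℝ → ℝ
x + y = mkℝ (λ n → seq x n ℚ.+ seq y n) λ ε ε>0 →
  let (M , p) = cauchy x (½ ℚ.* ε) (½ε>0 ε>0)
      (N , q) = cauchy y (½ ℚ.* ε) (½ε>0 ε>0)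
  in M ℕ.⊔ N , λ m n m≥ n≥ →
    let a = seq x m ; b = seq x n ; c = seq y m ; d = seq y n
        open ℚ.≤-Reasoning
    in begin
      ℚ.∣ (a ℚ.+ c) ℚ.- (b ℚ.+ d) ∣
        ≡⟨ cong ℚ.∣_∣ (rearrange a b c d) ⟩
      ℚ.∣ (a ℚ.- b) ℚ.+ (c ℚ.- d) ∣
        ≤⟨ ℚ.∣p+q∣≤∣p∣+∣q∣ (a ℚ.- b) (c ℚ.- d) ⟩
      ℚ.∣ a ℚ.- b ∣ ℚ.+ ℚ.∣ c ℚ.- d ∣
        ≤⟨ ℚ.+-mono-≤
             (p m n (ℕ.m⊔n≤o⇒m≤o M N m≥) (ℕ.m⊔n≤o⇒m≤o M N n≥))
             (q m n (ℕ.m⊔n≤o⇒n≤o M N m≥) (ℕ.m⊔n≤o⇒n≤o M N n≥)) ⟩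
      ½ ℚ.* ε ℚ.+ ½ ℚ.* ε
        ≡⟨ ½ε+½ε ε ⟩
      ε ∎
  where
  open +-*-Solver
  rearrange : ∀ a b c d → (a ℚ.+ c) ℚ.- (b ℚ.+ d) ≡ (a ℚ.- b) ℚ.+ (c ℚ.- d)
  rearrange = solve 4 (λ a b c d → (a :+ c) :- (b :+ d) := (a :- b) :+ (c :- d)) refl

-_ : ℝ → ℝ
- x = mkℝ (λ n → ℚ.- seq x n) λ ε ε>0 →
  let (N , p) = cauchy x ε ε>0
  in N , λ m n m≥ n≥ → subst (ℚ._≤ ε)
       (trans (sym (ℚ.∣-p∣≡∣p∣ (seq x m ℚ.- seq x n)))
              (cong ℚ.∣_∣ (ℚ.neg-distrib-+ (seq x m) (ℚ.- seq x n))))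
       (p m n m≥ n≥)

_-_ : ℝ → ℝ → ℝ
x - y = x + (- y)

∣_∣ : ℝ → ℝ
∣ x ∣ = mkℝ (λ n → ℚ.∣ seq x n ∣) λ ε ε>0 →
  let (N , p) = cauchy x ε ε>0
  in N , λ m n m≥ n≥ → ℚ.≤-trans (reverse△ (seq x m) (seq x n)) (p m n m≥ n≥)
  where
  open ℚ.≤-Reasoning
  open +-*-Solver using (solve; _:+_; _:-_; :-_; _:=_)

  half : ∀ a b → ℚ.∣ a ∣ ℚ.- ℚ.∣ b ∣ ℚ.≤ ℚ.∣ a ℚ.- b ∣
  half a b = begin
    ℚ.∣ a ∣ ℚ.- ℚ.∣ b ∣
      ≡⟨ cong (λ t → ℚ.∣ t ∣ ℚ.- ℚ.∣ b ∣)
           (solve 2 (λ a b → a := (a :- b) :+ b) refl a b) ⟩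
    ℚ.∣ (a ℚ.- b) ℚ.+ b ∣ ℚ.- ℚ.∣ b ∣
      ≤⟨ ℚ.+-monoˡ-≤ (ℚ.- ℚ.∣ b ∣) (ℚ.∣p+q∣≤∣p∣+∣q∣ (a ℚ.- b) b) ⟩
    ℚ.∣ a ℚ.- b ∣ ℚ.+ ℚ.∣ b ∣ ℚ.- ℚ.∣ b ∣
      ≡⟨ solve 2 (λ u v → u :+ v :- v := u) refl ℚ.∣ a ℚ.- b ∣ ℚ.∣ b ∣ ⟩
    ℚ.∣ a ℚ.- b ∣ ∎

  flip-- : ∀ a b → ℚ.- (a ℚ.- b) ≡ b ℚ.- a
  flip-- = solve 2 (λ a b → :- (a :- b) := b :- a) refl

  reverse△ : ∀ a b → ℚ.∣ ℚ.∣ a ∣ ℚ.- ℚ.∣ b ∣ ∣ ℚ.≤ ℚ.∣ a ℚ.- b ∣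
  reverse△ a b with ℚ.∣p∣≡p∨∣p∣≡-p (ℚ.∣ a ∣ ℚ.- ℚ.∣ b ∣)
  ... | inj₁ e = subst (ℚ._≤ ℚ.∣ a ℚ.- b ∣) (sym e) (half a b)
  ... | inj₂ e = subst₂ ℚ._≤_
      (sym (trans e (flip-- ℚ.∣ a ∣ ℚ.∣ b ∣)))
      (trans (cong ℚ.∣_∣ (sym (flip-- a b))) (ℚ.∣-p∣≡∣p∣ (a ℚ.- b)))
      (half b a)

private
  bound : ∀ x → ∃[ B ] (0ℚ ℚ.< B × ∃[ N ] (∀ n → N ℕ.≤ n → ℚ.∣ seq x n ∣ ℚ.≤ B))
  bound x with cauchy x 1ℚ (ℚ.positive⁻¹ 1ℚ)
  ... | N , p = B , B>0 , N , λ n n≥ → begin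
      ℚ.∣ seq x n ∣
        ≡⟨ cong ℚ.∣_∣ (solve 2 (λ a b → a := (a :- b) :+ b) refl (seq x n) (seq x N)) ⟩
      ℚ.∣ (seq x n ℚ.- seq x N) ℚ.+ seq x N ∣
        ≤⟨ ℚ.∣p+q∣≤∣p∣+∣q∣ (seq x n ℚ.- seq x N) (seq x N) ⟩
      ℚ.∣ seq x n ℚ.- seq x N ∣ ℚ.+ ℚ.∣ seq x N ∣
        ≤⟨ ℚ.+-monoˡ-≤ ℚ.∣ seq x N ∣ (p n N n≥ ℕ.≤-refl) ⟩
      B ∎
    where
    open ℚ.≤-Reasoning
    open +-*-Solver using (solve; _:+_; _:-_; _:=_)
    B : ℚ
    B = 1ℚ ℚ.+ ℚ.∣ seq x N ∣
    B>0 : 0ℚ ℚ.< B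
    B>0 = ℚ.positive⁻¹ B
      {{ℚ.pos+nonNeg⇒pos 1ℚ ℚ.∣ seq x N ∣ {{ℚ.∣-∣-nonNeg (seq x N)}}}}

  *-estimate : ∀ a b c d {A B e f g} → 0ℚ ℚ.≤ e → 0ℚ ℚ.≤ f →
    ℚ.∣ a ∣ ℚ.≤ A → ℚ.∣ d ∣ ℚ.≤ B → ℚ.∣ c ℚ.- d ∣ ℚ.≤ e → ℚ.∣ a ℚ.- b ∣ ℚ.≤ f →
    A ℚ.* e ≡ g → B ℚ.* f ≡ g → ℚ.∣ a ℚ.* c ℚ.- b ℚ.* d ∣ ℚ.≤ g ℚ.+ g
  *-estimate a b c d {A} {B} {e} {f} {g} e≥0 f≥0 p q r s eA eB = begin
      ℚ.∣ a ℚ.* c ℚ.- b ℚ.* d ∣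
        ≡⟨ cong ℚ.∣_∣ (solve 4 (λ a b c d →
             (a :* c) :- (b :* d) := (a :* (c :- d)) :+ (d :* (a :- b))) refl a b c d) ⟩
      ℚ.∣ a ℚ.* (c ℚ.- d) ℚ.+ d ℚ.* (a ℚ.- b) ∣
        ≤⟨ ℚ.∣p+q∣≤∣p∣+∣q∣ (a ℚ.* (c ℚ.- d)) (d ℚ.* (a ℚ.- b)) ⟩
      ℚ.∣ a ℚ.* (c ℚ.- d) ∣ ℚ.+ ℚ.∣ d ℚ.* (a ℚ.- b) ∣
        ≡⟨ cong₂ ℚ._+_ (ℚ.∣p*q∣≡∣p∣*∣q∣ a (c ℚ.- d)) (ℚ.∣p*q∣≡∣p∣*∣q∣ d (a ℚ.- b)) ⟩
      ℚ.∣ a ∣ ℚ.* ℚ.∣ c ℚ.- d ∣ ℚ.+ ℚ.∣ d ∣ ℚ.* ℚ.∣ a ℚ.- b ∣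
        ≤⟨ ℚ.+-mono-≤ (*-mono-≤ (ℚ.0≤∣p∣ a) e≥0 p r) (*-mono-≤ (ℚ.0≤∣p∣ d) f≥0 q s) ⟩
      A ℚ.* e ℚ.+ B ℚ.* f
        ≡⟨ cong₂ ℚ._+_ eA eB ⟩
      g ℚ.+ g ∎
    where
    open ℚ.≤-Reasoning
    open +-*-Solver using (solve; _:+_; _:-_; _:*_; _:=_)

_*_ : ℝ → ℝ → ℝ
x * y = mkℝ (λ n → seq x n ℚ.* seq y n) λ ε ε>0 →
  let (A , A>0 , K , p) = bound x
      (B , B>0 , L , q) = bound y
      h = ½ ℚ.* ε
      e>0 = quot>0 A A>0 (½ε>0 ε>0)
      f>0 = quot>0 B B>0 (½ε>0 ε>0)
      (M , r) = cauchy y (quot A A>0 h) e>0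
      (N , s) = cauchy x (quot B B>0 h) f>0
      kl : ∀ {j} → (K ℕ.⊔ L) ℕ.⊔ (M ℕ.⊔ N) ℕ.≤ j → K ℕ.⊔ L ℕ.≤ j
      kl = ℕ.m⊔n≤o⇒m≤o (K ℕ.⊔ L) (M ℕ.⊔ N)
      mn : ∀ {j} → (K ℕ.⊔ L) ℕ.⊔ (M ℕ.⊔ N) ℕ.≤ j → M ℕ.⊔ N ℕ.≤ j
      mn = ℕ.m⊔n≤o⇒n≤o (K ℕ.⊔ L) (M ℕ.⊔ N)
  in (K ℕ.⊔ L) ℕ.⊔ (M ℕ.⊔ N) , λ m n m≥ n≥ →
    subst (ℚ.∣ seq x m ℚ.* seq y m ℚ.- seq x n ℚ.* seq y n ∣ ℚ.≤_) (½ε+½ε ε)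
      (*-estimate (seq x m) (seq x n) (seq y m) (seq y n)
        (ℚ.<⇒≤ e>0) (ℚ.<⇒≤ f>0)
        (p m (ℕ.m⊔n≤o⇒m≤o K L (kl m≥)))
        (q n (ℕ.m⊔n≤o⇒n≤o K L (kl n≥)))
        (r m n (ℕ.m⊔n≤o⇒m≤o M N (mn m≥)) (ℕ.m⊔n≤o⇒m≤o M N (mn n≥)))
        (s m n (ℕ.m⊔n≤o⇒n≤o M N (mn m≥)) (ℕ.m⊔n≤o⇒n≤o M N (mn n≥)))
        (*-quot A A>0 h) (*-quot B B>0 h))

_^_ : ℝ → ℕ → ℝ
x ^ zero  = 1ᴿ
x ^ suc n = x * x ^ n

infix 9 1/suc_

-- 1/suc n = 1 / (n + 1)
1/suc_ : ℕ → ℝ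
1/suc n = fromℚ (+ 1 ℚ./ suc n)

-- The inverse of a positive real.  With N and c read off the proof of
-- 0 < x, every x_{N+n} is at least c, so the shifted sequence can be
-- inverted termwise.
module _ (x : ℝ) (x>0 : 0ᴿ < x) where
  private
    c : ℚ
    c = proj₁ x>0
    c>0 : 0ℚ ℚ.< c
    c>0 = proj₁ (proj₂ x>0)
    N : ℕ
    N = proj₁ (proj₂ (proj₂ x>0))

    s : ℕ → ℚ
    s n = seq x (N ℕ.+ n)

    c≤s : ∀ n → c ℚ.≤ s n
    c≤s n = subst (ℚ._≤ s n) (ℚ.+-identityˡ c)
      (proj₂ (proj₂ (proj₂ x>0)) (N ℕ.+ n) (ℕ.m≤m+n N n))

    s>0 : ∀ n → 0ℚ ℚ.< s n
    s>0 n = ℚ.<-≤-trans c>0 (c≤s n)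

    i : ℕ → ℚ
    i n = c⁻¹ (s n) (s>0 n)

    i≥0 : ∀ n → 0ℚ ℚ.≤ i n
    i≥0 n = ℚ.<⇒≤ (ℚ.positive⁻¹ (i n) {{ℚ.1/pos⇒pos (s n) {{ℚ.positive (s>0 n)}}}})

    s*i : ∀ n → s n ℚ.* i n ≡ 1ℚ
    s*i n = ℚ.*-inverseʳ (s n) {{ℚ.>-nonZero (s>0 n)}}

    i≤ : ∀ n → i n ℚ.≤ c⁻¹ c c>0
    i≤ n = begin
      i n
        ≡⟨ sym (*-quot c c>0 (i n)) ⟩
      c ℚ.* (c⁻¹ c c>0 ℚ.* i n)
        ≡⟨ solve 3 (λ a b d → a :* (b :* d) := b :* (a :* d)) refl c (c⁻¹ c c>0) (i n) ⟩
      c⁻¹ c c>0 ℚ.* (c ℚ.* i n)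
        ≤⟨ ℚ.*-monoˡ-≤-nonNeg (c⁻¹ c c>0)
             {{ℚ.pos⇒nonNeg (c⁻¹ c c>0) {{ℚ.1/pos⇒pos c {{ℚ.positive c>0}}}}}}
             (ℚ.*-monoʳ-≤-nonNeg (i n) {{ℚ.nonNegative (i≥0 n)}} (c≤s n)) ⟩
      c⁻¹ c c>0 ℚ.* (s n ℚ.* i n)
        ≡⟨ cong (c⁻¹ c c>0 ℚ.*_) (s*i n) ⟩
      c⁻¹ c c>0 ℚ.* 1ℚ
        ≡⟨ ℚ.*-identityʳ (c⁻¹ c c>0) ⟩
      c⁻¹ c c>0 ∎
      where
      open ℚ.≤-Reasoning
      open +-*-Solver using (solve; _:*_; _:=_)

    diff : ∀ m n → i m ℚ.- i n ≡ (i m ℚ.* i n) ℚ.* (s n ℚ.- s m)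
    diff m n = sym (begin
      (i m ℚ.* i n) ℚ.* (s n ℚ.- s m)
        ≡⟨ solve 4 (λ a b u v → (a :* b) :* (v :- u) :=
             (a :* (v :* b)) :- (b :* (u :* a))) refl (i m) (i n) (s m) (s n) ⟩
      i m ℚ.* (s n ℚ.* i n) ℚ.- i n ℚ.* (s m ℚ.* i m)
        ≡⟨ cong₂ (λ u v → i m ℚ.* u ℚ.- i n ℚ.* v) (s*i n) (s*i m) ⟩
      i m ℚ.* 1ℚ ℚ.- i n ℚ.* 1ℚ
        ≡⟨ cong₂ ℚ._-_ (ℚ.*-identityʳ (i m)) (ℚ.*-identityʳ (i n)) ⟩
      i m ℚ.- i n ∎)
      where
      open ≡-Reasoning
      open +-*-Solver using (solve; _:*_; _:-_; _:=_)

    prf : Cauchy i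
    prf ε ε>0 with cauchy x (c ℚ.* (c ℚ.* ε)) cce>0
      where
      cce>0 : 0ℚ ℚ.< c ℚ.* (c ℚ.* ε)
      cce>0 = ℚ.positive⁻¹ (c ℚ.* (c ℚ.* ε))
        {{ℚ.pos*pos⇒pos c {{ℚ.positive c>0}} (c ℚ.* ε)
          {{ℚ.pos*pos⇒pos c {{ℚ.positive c>0}} ε {{ℚ.positive ε>0}}}}}}
    ... | M , p = M , λ m n m≥ n≥ → begin
      ℚ.∣ i m ℚ.- i n ∣
        ≡⟨ cong ℚ.∣_∣ (diff m n) ⟩
      ℚ.∣ (i m ℚ.* i n) ℚ.* (s n ℚ.- s m) ∣
        ≡⟨ ℚ.∣p*q∣≡∣p∣*∣q∣ (i m ℚ.* i n) (s n ℚ.- s m) ⟩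
      ℚ.∣ i m ℚ.* i n ∣ ℚ.* ℚ.∣ s n ℚ.- s m ∣
        ≤⟨ *-mono-≤ (ℚ.0≤∣p∣ (i m ℚ.* i n)) (ℚ.≤-trans (ℚ.0≤∣p∣ (s n ℚ.- s m)) (close n m n≥ m≥))
             (ℚ.≤-trans (ℚ.≤-reflexive (trans (ℚ.∣p*q∣≡∣p∣*∣q∣ (i m) (i n))
                           (cong₂ ℚ._*_ (ℚ.0≤p⇒∣p∣≡p (i≥0 m)) (ℚ.0≤p⇒∣p∣≡p (i≥0 n)))))
                        (*-mono-≤ (i≥0 m) (ℚ.≤-trans (i≥0 n) (i≤ n)) (i≤ m) (i≤ n)))
             (close n m n≥ m≥) ⟩
      (d ℚ.* d) ℚ.* (c ℚ.* (c ℚ.* ε))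
        ≡⟨ solve 3 (λ c d e → (d :* d) :* (c :* (c :* e)) :=
             (c :* (d :* (c :* (d :* e))))) refl c d ε ⟩
      c ℚ.* (d ℚ.* (c ℚ.* (d ℚ.* ε)))
        ≡⟨ *-quot c c>0 _ ⟩
      c ℚ.* (d ℚ.* ε)
        ≡⟨ *-quot c c>0 ε ⟩
      ε ∎
      where
      open ℚ.≤-Reasoning
      open +-*-Solver using (solve; _:*_; _:=_)
      d : ℚ
      d = c⁻¹ c c>0
      close : ∀ m n → M ℕ.≤ m → M ℕ.≤ n → ℚ.∣ s m ℚ.- s n ∣ ℚ.≤ c ℚ.* (c ℚ.* ε)
      close m n m≥ n≥ = p (N ℕ.+ m) (N ℕ.+ n)
        (ℕ.≤-trans m≥ (ℕ.m≤n+m m N)) (ℕ.≤-trans n≥ (ℕ.m≤n+m n N))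

  inv : ℝ
  inv = mkℝ i prf

------------------------------------------------------------------------
-- Limits and series

infix 4 _⟶_

_⟶_ : (ℕ → ℝ) → ℝ → Set
s ⟶ x = ∀ (ε : ℚ) → 0ℚ ℚ.< ε → ∃[ N ] (∀ n → N ℕ.≤ n → ∣ s n - x ∣ ≤ fromℚ ε)

∑< : ℕ → (ℕ → ℝ) → ℝ
∑< zero    f = 0ᴿ
∑< (suc n) f = ∑< n f + f n

HasSum : (ℕ → ℝ) → ℝ → Set
HasSum f x = (λ n → ∑< n f) ⟶ x

------------------------------------------------------------------------
-- The functions and constants are given by their graphs: a term of
-- F x y says that F is defined at x with value y.  Every series below is
-- indexed from 1, so the summation variable is suc of the bound index.

1/!_ : ℕ → ℝ
1/! n = fromℚ (ℚ._/_ (+ 1) (n !) {{n ℕ.!≢0}})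

Exp : ℝ → ℝ → Set
Exp x y = HasSum (λ n → x ^ n * 1/! n) y

-- The natural logarithm is the inverse of exp.
Log : ℝ → ℝ → Set
Log x y = Exp y x

Li₂ : ℝ → ℝ → Set
Li₂ z y = HasSum (λ n → z ^ suc n * (1/suc n) ^ 2) y

-- Σ_{n ≥ 1} (Li₂(z/n) − z/n), where a lists the values Li₂(z/1), Li₂(z/2), …
𝒵₂ : ℝ → ℝ → Set
𝒵₂ z y = Σ[ a ∈ (ℕ → ℝ) ]
  (∀ n → Li₂ (z * 1/suc n) (a n)) ×
  HasSum (λ n → a n - z * 1/suc n) y

-- γ = lim_{n ≥ 1} (Σ_{k=1}^{n} 1/k − log n), where l lists log 1, log 2, …
EulerConstant : ℝ → Set
EulerConstant γ = Σ[ l ∈ (ℕ → ℝ) ]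
  (∀ n → Log (fromℕ (suc n)) (l n)) ×
  ((λ n → ∑< (suc n) 1/suc_ - l n) ⟶ γ)

-- lim_{n ≥ 1} (Σ_{k=1}^{n} Li₂(1/k) − log n)
ConstantC₂ : ℝ → Set
ConstantC₂ c = Σ[ a ∈ (ℕ → ℝ) ] Σ[ l ∈ (ℕ → ℝ) ]
  (∀ n → Li₂ (1/suc n) (a n)) ×
  (∀ n → Log (fromℕ (suc n)) (l n)) ×
  ((λ n → ∑< (suc n) a - l n) ⟶ c)

-- With e = 1 − z, the series for 𝒵₂ at 1 and at z differ by Σₙ Σₖ (1 − zᵏ)/(nᵏk²), less the linear
-- terms.  For n ≥ 2 the inner sums without k = 1 are at most e/(n(n − 1)).  For n = 1, cut the
-- sum over k at N ≈ 1/e: since 1 − zᵏ = ke + O(k²e²) and 0 ≤ 1 − zᵏ ≤ 1, it equals e H_N + O(e).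
-- The inequality (1 + b)eᵃ ≤ eᵃ⁺ᵇ, for a, a + b ≥ 0 and with b = ± 1/k, telescopes to
-- N + 1 ≤ exp H_N and exp (H_N − 1) ≤ N, so log (1/e) = H_N + O(1).  It also makes exp injective on
-- [0, ∞), whence the logarithms in γ and in C₂ agree and C₂ − γ is the value of the series at 1;
-- negative logarithms do not occur since exp is bounded by 2 there.
-- All estimates are made on partial sums at rational representatives of the reals.
module Submission where

import Data.Integer.Base as ℤ
import Data.Integer.Properties as ℤ
import Data.Nat.Base as ℕ
import Data.Nat.Properties as ℕ
import Defs as R
open import Data.Empty using (⊥; ⊥-elim)
open import Data.Sum.Base using (inj₁; inj₂)
open import Relation.Binary.PropositionalEquality
open import Data.Product using (∃-syntax; _×_; _,_; proj₁; proj₂)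

-- On representatives, a convergent series says something only for a number of terms fixed first and
-- then for all late indices. So every fact about exp has to be proved for the polynomials `E n`
-- themselves. As the derivative of `E (suc n)` is `E n`, each use of the growth inequality costs
-- one term, which explains the shifted term counts throughout. At negative arguments only an even
-- number of terms keeps `E n` bounded above. The order of the reals is undecidable, so the cutoff
-- is computed from one rational approximation of ε, and `Scale` leaves room for all later ones. The
-- final constant 10 is made up of 4 for replacing the sum over k at n = 1 by e H_N, 4 for replacing
-- H_N by log (1/ε), 1 for the linear term at n = 1, and 1 for all n ≥ 2 together, whose bounds
-- telescope.

module Estimates where

  open import Data.Nat.Base using (ℕ; zero; suc; _!)
  open import Data.Rational.Base
  open import Data.Rational.Properties
  import Data.Rational.Unnormalised.Base as ℚᵘ
  import Data.Rational.Unnormalised.Properties as ℚᵘ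
  open import Data.Rational.Solver using (module +-*-Solver)
  open +-*-Solver using (solve; _:+_; _:-_; _:*_; :-_; _:=_; con)
  open R using (ℝ; seq; cauchy; _⟶_; HasSum; Exp; Log; Li₂; 1/suc_; inv; fromℕ; fromℚ; 0ᴿ; 1ᴿ; ∑<)

  -- Order

  infixl 6 _⊕_
  infixl 7 _⊗_

  _⊕_ : ∀ {p q} → 0ℚ ≤ p → 0ℚ ≤ q → 0ℚ ≤ p + q
  _⊕_ = +-mono-≤

  _⊗_ : ∀ {p q} → 0ℚ ≤ p → 0ℚ ≤ q → 0ℚ ≤ p * q
  _⊗_ {p} {q} p≥0 q≥0 = nonNegative⁻¹ (p * q)
    {{nonNeg*nonNeg⇒nonNeg p {{nonNegative p≥0}} q {{nonNegative q≥0}}}}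

  gap : ∀ {p q} → p ≤ q → 0ℚ ≤ q - p
  gap {p} {q} p≤q = subst (_≤ q - p) (+-inverseʳ p) (+-monoˡ-≤ (- p) p≤q)

  -- The standard form of an inequality below: the difference `r` is written as a combination of
  -- quantities known to be nonnegative, and the ring solver checks the identity.
  ≤-by : ∀ {p q r} → 0ℚ ≤ r → q ≡ p + r → p ≤ q
  ≤-by {p} r≥0 refl = subst (_≤ p + _) (+-identityʳ p) (+-monoʳ-≤ p r≥0)

  0≤1 : 0ℚ ≤ 1ℚ
  0≤1 = nonNegative⁻¹ 1ℚ

  0<½ : 0ℚ < ½
  0<½ = positive⁻¹ ½

  *-pos : ∀ {p q} → 0ℚ < p → 0ℚ < q → 0ℚ < p * q
  *-pos {p} {q} p>0 q>0 = positive⁻¹ (p * q)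
    {{pos*pos⇒pos p {{positive p>0}} q {{positive q>0}}}}

  *-cancelˡ-≤ : ∀ {c p q} → 0ℚ < c → c * p ≤ c * q → p ≤ q
  *-cancelˡ-≤ {c} c>0 = *-cancelˡ-≤-pos c {{positive c>0}}

  *-nonNeg-cancel : ∀ {c p} → 0ℚ < c → 0ℚ ≤ c * p → 0ℚ ≤ p
  *-nonNeg-cancel {c} {p} c>0 h = *-cancelˡ-≤ c>0 (subst (_≤ c * p) (sym (*-zeroʳ c)) h)

  0≤p*p : ∀ p → 0ℚ ≤ p * p
  0≤p*p p with ≤-total 0ℚ p
  ... | inj₁ p≥0 = p≥0 ⊗ p≥0
  ... | inj₂ p≤0 = subst (0ℚ ≤_) (lem p) (gap p≤0 ⊗ gap p≤0)
    where
    lem : ∀ p → (0ℚ - p) * (0ℚ - p) ≡ p * p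
    lem = solve 1 (λ p → (con 0ℚ :- p) :* (con 0ℚ :- p) := p :* p) refl

  p≤∣p∣ : ∀ p → p ≤ ∣ p ∣
  p≤∣p∣ p with ≤-total 0ℚ p
  ... | inj₁ p≥0 = ≤-reflexive (sym (0≤p⇒∣p∣≡p p≥0))
  ... | inj₂ p≤0 = ≤-trans p≤0 (0≤∣p∣ p)

  ∣p∣≤⇒p≤ : ∀ {p c} → ∣ p ∣ ≤ c → p ≤ c
  ∣p∣≤⇒p≤ {p} = ≤-trans (p≤∣p∣ p)

  ∣p∣≤⇒-p≤ : ∀ {p c} → ∣ p ∣ ≤ c → - p ≤ c
  ∣p∣≤⇒-p≤ {p} h = ≤-trans (p≤∣p∣ (- p)) (subst (_≤ _) (sym (∣-p∣≡∣p∣ p)) h)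

  ∣∣≤-intro : ∀ {p c} → p ≤ c → - p ≤ c → ∣ p ∣ ≤ c
  ∣∣≤-intro {p} h k with ∣p∣≡p∨∣p∣≡-p p
  ... | inj₁ e = subst (_≤ _) (sym e) h
  ... | inj₂ e = subst (_≤ _) (sym e) k

  ∣∣≤-+ : ∀ {p q c d} → ∣ p ∣ ≤ c → ∣ q ∣ ≤ d → ∣ p + q ∣ ≤ c + d
  ∣∣≤-+ {p} {q} h k = ≤-trans (∣p+q∣≤∣p∣+∣q∣ p q) (+-mono-≤ h k)

  ∣∣≤-* : ∀ {p q c d} → ∣ p ∣ ≤ c → ∣ q ∣ ≤ d → ∣ p * q ∣ ≤ c * d
  ∣∣≤-* {p} {q} {c} {d} h k = subst (_≤ c * d) (sym (∣p*q∣≡∣p∣*∣q∣ p q))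
    (≤-by (gap h ⊗ 0≤∣p∣ q ⊕ ≤-trans (0≤∣p∣ p) h ⊗ gap k) (lem ∣ p ∣ ∣ q ∣ c d))
    where
    lem : ∀ p q c d → c * d ≡ p * q + ((c - p) * q + c * (d - q))
    lem = solve 4 (λ p q c d → c :* d := p :* q :+ ((c :- p) :* q :+ c :* (d :- q))) refl

  ∣∣≤-neg : ∀ {p c} → ∣ p ∣ ≤ c → ∣ - p ∣ ≤ c
  ∣∣≤-neg {p} = subst (_≤ _) (sym (∣-p∣≡∣p∣ p))

  -- Natural numbers and unit fractions in ℚ

  ⟦_⟧ : ℕ → ℚ
  ⟦ n ⟧ = ℤ.+ n / 1

  recip : ℕ → ℚ
  recip n = ℤ.+ 1 / suc n

  private
    toℚᵘ-/ : ∀ n d → toℚᵘ (ℤ.+ n / suc d) ℚᵘ.≃ ℚᵘ.mkℚᵘ (ℤ.+ n) d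
    toℚᵘ-/ n d = toℚᵘ-fromℚᵘ (ℚᵘ.mkℚᵘ (ℤ.+ n) d)

  ⟦⟧-suc : ∀ n → ⟦ suc n ⟧ ≡ 1ℚ + ⟦ n ⟧
  ⟦⟧-suc n = toℚᵘ-injective (ℚᵘ.≃-trans (toℚᵘ-/ (suc n) 0)
    (ℚᵘ.≃-trans (ℚᵘ.*≡* (cong (ℤ._* (ℤ.+ 1)) (cong (λ i → (ℤ.+ 1) ℤ.+ i) (sym (ℤ.*-identityʳ (ℤ.+ n))))))
    (ℚᵘ.≃-sym (ℚᵘ.≃-trans (toℚᵘ-homo-+ 1ℚ ⟦ n ⟧) (ℚᵘ.+-cong (ℚᵘ.≃-refl {toℚᵘ 1ℚ}) (toℚᵘ-/ n 0))))))

  ⟦⟧-* : ∀ m n → ⟦ m ℕ.* n ⟧ ≡ ⟦ m ⟧ * ⟦ n ⟧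
  ⟦⟧-* m n = toℚᵘ-injective (ℚᵘ.≃-trans (toℚᵘ-/ (m ℕ.* n) 0)
    (ℚᵘ.≃-trans (ℚᵘ.*≡* (cong (ℤ._* (ℤ.+ 1)) (ℤ.pos-* m n)))
    (ℚᵘ.≃-sym (ℚᵘ.≃-trans (toℚᵘ-homo-* ⟦ m ⟧ ⟦ n ⟧)
                           (ℚᵘ.*-cong (toℚᵘ-/ m 0) (toℚᵘ-/ n 0))))))

  ⟦⟧*1/ : ∀ n .{{_ : ℕ.NonZero n}} → ⟦ n ⟧ * (ℤ.+ 1 / n) ≡ 1ℚ
  ⟦⟧*1/ (suc n) = toℚᵘ-injective (ℚᵘ.≃-trans (toℚᵘ-homo-* ⟦ suc n ⟧ (recip n))
    (ℚᵘ.≃-trans (ℚᵘ.*-cong (toℚᵘ-/ (suc n) 0) (toℚᵘ-/ 1 n))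
    (ℚᵘ.*≡* (trans (ℤ.*-identityʳ _) (trans (ℤ.*-comm (ℤ.+ suc n) (ℤ.+ 1))
       (cong (λ k → (ℤ.+ 1) ℤ.* (ℤ.+ suc k)) (sym (ℕ.+-identityʳ n))))))))

  ⟦⟧-recip : ∀ n → ⟦ suc n ⟧ * recip n ≡ 1ℚ
  ⟦⟧-recip n = ⟦⟧*1/ (suc n)

  0≤⟦⟧ : ∀ n → 0ℚ ≤ ⟦ n ⟧
  0≤⟦⟧ n = nonNegative⁻¹ ⟦ n ⟧ {{normalize-nonNeg n 1}}

  1≤⟦suc⟧ : ∀ n → 1ℚ ≤ ⟦ suc n ⟧
  1≤⟦suc⟧ n = ≤-by (0≤⟦⟧ n) (⟦⟧-suc n)

  0<⟦suc⟧ : ∀ n → 0ℚ < ⟦ suc n ⟧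
  0<⟦suc⟧ n = <-≤-trans (positive⁻¹ 1ℚ) (1≤⟦suc⟧ n)

  ⟦⟧-mono : ∀ {m n} → m ℕ.≤ n → ⟦ m ⟧ ≤ ⟦ n ⟧
  ⟦⟧-mono {n = n} ℕ.z≤n = 0≤⟦⟧ n
  ⟦⟧-mono {suc m} {suc n} (ℕ.s≤s m≤n) =
    subst₂ _≤_ (sym (⟦⟧-suc m)) (sym (⟦⟧-suc n)) (+-monoʳ-≤ 1ℚ (⟦⟧-mono m≤n))

  0≤recip : ∀ n → 0ℚ ≤ recip n
  0≤recip n = nonNegative⁻¹ (recip n) {{normalize-nonNeg 1 (suc n)}}

  recip≤1 : ∀ n → recip n ≤ 1ℚ
  recip≤1 n = ≤-by (gap (1≤⟦suc⟧ n) ⊗ 0≤recip n)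
    (trans (sym (⟦⟧-recip n)) (lem ⟦ suc n ⟧ (recip n)))
    where
    lem : ∀ c r → c * r ≡ r + (c - 1ℚ) * r
    lem = solve 2 (λ c r → c :* r := r :+ (c :- con 1ℚ) :* r) refl

  recip-telescope : ∀ n → recip n * recip (suc n) ≡ recip n - recip (suc n)
  recip-telescope n = begin
    r * s                                     ≡⟨ lem ⟦ suc n ⟧ r s ⟩
    r * ((1ℚ + ⟦ suc n ⟧) * s) - (⟦ suc n ⟧ * r) * s
      ≡⟨ cong₂ (λ u v → r * u - v * s)
           (trans (cong (_* s) (sym (⟦⟧-suc (suc n)))) (⟦⟧-recip (suc n))) (⟦⟧-recip n) ⟩
    r * 1ℚ - 1ℚ * s                           ≡⟨ cong₂ _-_ (*-identityʳ r) (*-identityˡ s) ⟩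
    r - s ∎
    where
    open ≡-Reasoning
    r s : ℚ
    r = recip n
    s = recip (suc n)
    lem : ∀ c r s → r * s ≡ r * ((1ℚ + c) * s) - (c * r) * s
    lem = solve 3 (λ c r s → r :* s := r :* ((con 1ℚ :+ c) :* s) :- c :* r :* s) refl

  recip-anti : ∀ n → recip (suc n) ≤ recip n
  recip-anti n = ≤-by (0≤recip n ⊗ 0≤recip (suc n))
    (trans (lem (recip n) (recip (suc n))) (cong (recip (suc n) +_) (sym (recip-telescope n))))
    where
    lem : ∀ r s → r ≡ s + (r - s)
    lem = solve 2 (λ r s → r := s :+ (r :- s)) refl

  -- The absolute value of the numerator serves, since the denominator is at least 1.
  archimedean : ∀ p → ∃[ n ] p ≤ ⟦ n ⟧
  archimedean p@(mkℚ n d _) = ℤ.∣ n ∣ , toℚᵘ-cancel-≤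
    (ℚᵘ.≤-respʳ-≃ (ℚᵘ.≃-sym (toℚᵘ-/ ℤ.∣ n ∣ 0)) (ℚᵘ.*≤* (begin
      n ℤ.* (ℤ.+ 1)                  ≡⟨ ℤ.*-identityʳ n ⟩
      n                              ≤⟨ i≤∣i∣ n ⟩
      ℤ.+ ℤ.∣ n ∣                    ≤⟨ ℤ.+≤+ (ℕ.m≤m*n ℤ.∣ n ∣ (suc d)) ⟩
      ℤ.+ (ℤ.∣ n ∣ ℕ.* suc d)        ≡⟨ ℤ.pos-* ℤ.∣ n ∣ (suc d) ⟩
      (ℤ.+ ℤ.∣ n ∣) ℤ.* (ℤ.+ suc d)  ∎)))
    where
    open ℤ.≤-Reasoning
    i≤∣i∣ : ∀ i → i ℤ.≤ ℤ.+ ℤ.∣ i ∣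
    i≤∣i∣ (ℤ.+ _) = ℤ.≤-refl
    i≤∣i∣ (ℤ.-[1+ _ ]) = ℤ.-≤+

  -- Finite sums and powers

  sum : ℕ → (ℕ → ℚ) → ℚ
  sum zero    f = 0ℚ
  sum (suc n) f = sum n f + f n

  sum-cong : ∀ {f g} → (∀ k → f k ≡ g k) → ∀ n → sum n f ≡ sum n g
  sum-cong f≡g zero    = refl
  sum-cong f≡g (suc n) = cong₂ _+_ (sum-cong f≡g n) (f≡g n)

  0≤sum : ∀ {f} → (∀ k → 0ℚ ≤ f k) → ∀ n → 0ℚ ≤ sum n f
  0≤sum f≥0 zero    = ≤-refl
  0≤sum f≥0 (suc n) = 0≤sum f≥0 n ⊕ f≥0 n

  pow : ℚ → ℕ → ℚ
  pow x zero    = 1ℚ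
  pow x (suc n) = x * pow x n

  0≤pow : ∀ {x} → 0ℚ ≤ x → ∀ n → 0ℚ ≤ pow x n
  0≤pow x≥0 zero    = 0≤1
  0≤pow x≥0 (suc n) = x≥0 ⊗ 0≤pow x≥0 n

  pow-+ : ∀ x m n → pow x (m ℕ.+ n) ≡ pow x m * pow x n
  pow-+ x zero    n = sym (*-identityˡ (pow x n))
  pow-+ x (suc m) n = trans (cong (x *_) (pow-+ x m n)) (sym (*-assoc x (pow x m) (pow x n)))

  pow-* : ∀ x y n → pow (x * y) n ≡ pow x n * pow y n
  pow-* x y zero    = refl
  pow-* x y (suc n) = trans (cong (x * y *_) (pow-* x y n)) (lem x y (pow x n) (pow y n))
    where
    lem : ∀ x y u v → x * y * (u * v) ≡ x * u * (y * v)
    lem = solve 4 (λ x y u v → x :* y :* (u :* v) := x :* u :* (y :* v)) refl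

  pow-1 : ∀ n → pow 1ℚ n ≡ 1ℚ
  pow-1 zero    = refl
  pow-1 (suc n) = trans (*-identityˡ (pow 1ℚ n)) (pow-1 n)

  ∣pow∣≤ : ∀ {x X} → ∣ x ∣ ≤ X → ∀ n → ∣ pow x n ∣ ≤ pow X n
  ∣pow∣≤ h zero    = ≤-refl
  ∣pow∣≤ h (suc n) = ∣∣≤-* h (∣pow∣≤ h n)

  H : ℕ → ℚ
  H n = sum n recip

  0≤H : ∀ n → 0ℚ ≤ H n
  0≤H = 0≤sum 0≤recip

  1≤H-suc : ∀ n → 1ℚ ≤ H (suc n)
  1≤H-suc zero    = ≤-refl
  1≤H-suc (suc n) = ≤-trans (1≤H-suc n) (≤-by (0≤recip (suc n)) refl)

  -- The exponential polynomials

  invFact : ℕ → ℚ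
  invFact n = (ℤ.+ 1 / n !) {{n ℕ.!≢0}}

  0≤invFact : ∀ n → 0ℚ ≤ invFact n
  0≤invFact n = nonNegative⁻¹ (invFact n) {{normalize-nonNeg 1 (n !) {{n ℕ.!≢0}}}}

  ⟦⟧-invFact : ∀ n → ⟦ suc n ⟧ * invFact (suc n) ≡ invFact n
  ⟦⟧-invFact n = begin
    c * i                ≡⟨ sym (*-identityʳ (c * i)) ⟩
    c * i * 1ℚ           ≡⟨ cong (c * i *_) (sym (⟦⟧*1/ (n !) {{n ℕ.!≢0}})) ⟩
    c * i * (f * j)      ≡⟨ lem c i f j ⟩
    (c * f) * i * j      ≡⟨ cong (λ u → u * i * j) (sym (⟦⟧-* (suc n) (n !))) ⟩
    ⟦ suc n ! ⟧ * i * j  ≡⟨ cong (_* j) (⟦⟧*1/ (suc n !) {{suc n ℕ.!≢0}}) ⟩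
    1ℚ * j               ≡⟨ *-identityˡ j ⟩
    j                    ∎
    where
    open ≡-Reasoning
    c i f j : ℚ
    c = ⟦ suc n ⟧
    i = invFact (suc n)
    f = ⟦ n ! ⟧
    j = invFact n
    lem : ∀ c i f j → c * i * (f * j) ≡ (c * f) * i * j
    lem = solve 4 (λ c i f j → c :* i :* (f :* j) := c :* f :* i :* j) refl

  opaque
    term : ℕ → ℚ → ℚ
    term n x = pow x n * invFact n

    E : ℕ → ℚ → ℚ
    E n x = sum n (λ k → term k x)

    term-suc : ∀ n x → ⟦ suc n ⟧ * term (suc n) x ≡ x * term n x
    term-suc n x = trans (lem ⟦ suc n ⟧ x (pow x n) (invFact (suc n)))
      (cong (λ i → x * (pow x n * i)) (⟦⟧-invFact n))
      where
      lem : ∀ c x p i → c * (x * p * i) ≡ x * (p * (c * i))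
      lem = solve 4 (λ c x p i → c :* (x :* p :* i) := x :* (p :* (c :* i))) refl

    0≤term : ∀ n {x} → 0ℚ ≤ x → 0ℚ ≤ term n x
    0≤term n x≥0 = 0≤pow x≥0 n ⊗ 0≤invFact n

    ∣term∣≤ : ∀ n {x X} → ∣ x ∣ ≤ X → ∣ term n x ∣ ≤ term n X
    ∣term∣≤ n h = ∣∣≤-* (∣pow∣≤ h n) (≤-reflexive (0≤p⇒∣p∣≡p (0≤invFact n)))

    term-zero : ∀ n → term (suc n) 0ℚ ≡ 0ℚ
    term-zero n = trans (cong (_* invFact (suc n)) (*-zeroˡ (pow 0ℚ n))) (*-zeroˡ (invFact (suc n)))

    E-zero : ∀ n → E (suc n) 0ℚ ≡ 1ℚ
    E-zero zero    = refl
    E-zero (suc n) = cong₂ _+_ (E-zero n) (term-zero n)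

    1≤E-suc : ∀ n {x} → 0ℚ ≤ x → 1ℚ ≤ E (suc n) x
    1≤E-suc zero    x≥0 = ≤-refl
    1≤E-suc (suc n) x≥0 = ≤-trans (1≤E-suc n x≥0) (≤-by (0≤term (suc n) x≥0) refl)

    E-def : ∀ n x → E n x ≡ sum n (λ k → pow x k * invFact k)
    E-def n x = refl

    E-empty : ∀ x → E 0 x ≡ 0ℚ
    E-empty x = refl

    E-suc : ∀ n x → E (suc n) x ≡ E n x + term n x
    E-suc n x = refl

    -- The error of the first-order Taylor expansion of `term (suc n)` at `a`; the derivative of
    -- `term (suc n)` is `term n`.
    remainder : ℕ → ℚ → ℚ → ℚ
    remainder n a b = term (suc n) (a + b) - term (suc n) a - b * term n a

    remainder-zero : ∀ a b → remainder 0 a b ≡ 0ℚ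
    remainder-zero = solve 2 (λ a b →
      (a :+ b) :* con 1ℚ :* con 1ℚ :- a :* con 1ℚ :* con 1ℚ :- b :* (con 1ℚ :* con 1ℚ)
        := con 0ℚ) refl

    -- Follows from `term-suc` alone. By induction this recurrence gives both the sign of the
    -- remainder and its quadratic size in `b`, without the binomial theorem.
    remainder-suc : ∀ n a b →
      ⟦ suc (suc n) ⟧ * remainder (suc n) a b ≡ (a + b) * remainder n a b + b * b * term n a
    remainder-suc n a b = trans
      (lem₁ ⟦ suc (suc n) ⟧ (term (suc (suc n)) (a + b)) (term (suc (suc n)) a) b (term (suc n) a))
      (lem₂ (term-suc (suc n) (a + b)) (term-suc (suc n) a)
        (trans (cong (_* term (suc n) a) (⟦⟧-suc (suc n))) (trans
          (lem₃ ⟦ suc n ⟧ (term (suc n) a)) (cong (term (suc n) a +_) (term-suc n a)))))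
      where
      lem₁ : ∀ c u v b w → c * (u - v - b * w) ≡ c * u - c * v - b * (c * w)
      lem₁ = solve 5 (λ c u v b w →
        c :* (u :- v :- b :* w) := c :* u :- c :* v :- b :* (c :* w)) refl
      lem₃ : ∀ d w → (1ℚ + d) * w ≡ w + d * w
      lem₃ = solve 2 (λ d w → (con 1ℚ :+ d) :* w := w :+ d :* w) refl
      lem₂ : ∀ {u v w t s r} → u ≡ (a + b) * t → v ≡ a * s → w ≡ s + a * r →
        u - v - b * w ≡ (a + b) * (t - s - b * r) + b * b * r
      lem₂ {t = t} {s} {r} refl refl refl = lem a b t s r
        where
        lem : ∀ a b t s r → (a + b) * t - a * s - b * (s + a * r) ≡
          (a + b) * (t - s - b * r) + b * b * r
        lem = solve 5 (λ a b t s r →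
          (a :+ b) :* t :- a :* s :- b :* (s :+ a :* r) := (a :+ b) :* (t :- s :- b :* r)
            :+ b :* b :* r) refl

    -- The constant `term 0` has no remainder, so n + 1 terms leave only n remainders.
    E-taylor : ∀ n a b →
      E (suc n) (a + b) ≡ E (suc n) a + b * E n a + sum n (λ k → remainder k a b)
    E-taylor zero    a b = lem b (0ℚ + term 0 a)
      where
      lem : ∀ b u → u ≡ u + b * 0ℚ + 0ℚ
      lem = solve 2 (λ b u → u := u :+ b :* con 0ℚ :+ con 0ℚ) refl
    E-taylor (suc n) a b = trans (cong (_+ term (suc n) (a + b)) (E-taylor n a b))
      (lem (E (suc n) a) b (E n a) _ _ _ _)
      where
      lem : ∀ E₁ b E₀ s u v w → E₁ + b * E₀ + s + u ≡ (E₁ + v) + b * (E₀ + w) + (s + (u - v - b * w))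
      lem = solve 7 (λ E₁ b E₀ s u v w →
        E₁ :+ b :* E₀ :+ s :+ u := E₁ :+ v :+ b :* (E₀ :+ w) :+ (s :+ (u :- v :- b :* w))) refl

    term-odd-nonPos : ∀ k {x} → 0ℚ ≤ x → 0ℚ ≤ - term (suc (k ℕ.+ k)) (- x)
    term-odd-nonPos k {x} x≥0 = subst (0ℚ ≤_)
      (trans (lem x (pow (- x) k) i) (cong (λ p → - (- x * p * i)) (sym (pow-+ (- x) k k))))
      (x≥0 ⊗ 0≤p*p (pow (- x) k) ⊗ 0≤invFact (suc (k ℕ.+ k)))
      where
      i : ℚ
      i = invFact (suc (k ℕ.+ k))
      lem : ∀ x p i → x * (p * p) * i ≡ - (- x * (p * p) * i)
      lem = solve 3 (λ x p i → x :* (p :* p) :* i := :- ((:- x) :* (p :* p) :* i)) refl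

  0≤remainder : ∀ n {a b} → 0ℚ ≤ a → 0ℚ ≤ a + b → 0ℚ ≤ remainder n a b
  0≤remainder zero    {a} {b} a≥0 c≥0 = ≤-reflexive (sym (remainder-zero a b))
  0≤remainder (suc n) {a} {b} a≥0 c≥0 = *-nonNeg-cancel (0<⟦suc⟧ (suc n))
    (subst (0ℚ ≤_) (sym (remainder-suc n a b))
      (c≥0 ⊗ 0≤remainder n a≥0 c≥0 ⊕ 0≤p*p b ⊗ 0≤term n a≥0))

  -- The point is that `D` depends on `n` and `X` only, so one constant serves all steps of Euler's
  -- method on a fixed interval.
  ∣remainder∣≤ : ∀ n X → 0ℚ ≤ X → ∃[ D ] (0ℚ ≤ D ×
    (∀ {a b} → ∣ a ∣ ≤ X → ∣ a + b ∣ ≤ X → ∣ remainder n a b ∣ ≤ b * b * D))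
  ∣remainder∣≤ zero X X≥0 = 0ℚ , ≤-refl , λ {a} {b} _ _ →
    ≤-reflexive (trans (cong ∣_∣ (remainder-zero a b)) (sym (*-zeroʳ (b * b))))
  ∣remainder∣≤ (suc n) X X≥0 with ∣remainder∣≤ n X X≥0
  ... | D , D≥0 , bd = X * D + term n X , X≥0 ⊗ D≥0 ⊕ 0≤term n X≥0 , λ {a} {b} ha hc → begin
      ∣ remainder (suc n) a b ∣
        ≤⟨ ≤-by (gap (1≤⟦suc⟧ (suc n)) ⊗ 0≤∣p∣ (remainder (suc n) a b))
             (lem₁ ⟦ suc (suc n) ⟧ ∣ remainder (suc n) a b ∣) ⟩
      ⟦ suc (suc n) ⟧ * ∣ remainder (suc n) a b ∣
        ≡⟨ cong (_* ∣ remainder (suc n) a b ∣) (sym (0≤p⇒∣p∣≡p (0≤⟦⟧ (suc (suc n))))) ⟩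
      ∣ ⟦ suc (suc n) ⟧ ∣ * ∣ remainder (suc n) a b ∣
        ≡⟨ sym (∣p*q∣≡∣p∣*∣q∣ ⟦ suc (suc n) ⟧ (remainder (suc n) a b)) ⟩
      ∣ ⟦ suc (suc n) ⟧ * remainder (suc n) a b ∣
        ≡⟨ cong ∣_∣ (remainder-suc n a b) ⟩
      ∣ (a + b) * remainder n a b + b * b * term n a ∣
        ≤⟨ ∣∣≤-+ (∣∣≤-* hc (bd {a} {b} ha hc))
             (∣∣≤-* (≤-reflexive (0≤p⇒∣p∣≡p (0≤p*p b))) (∣term∣≤ n ha)) ⟩
      X * (b * b * D) + b * b * term n X
        ≡⟨ lem₂ X b D (term n X) ⟩
      b * b * (X * D + term n X) ∎
    where
    open ≤-Reasoning
    lem₁ : ∀ c r → c * r ≡ r + (c - 1ℚ) * r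
    lem₁ = solve 2 (λ c r → c :* r := r :+ (c :- con 1ℚ) :* r) refl
    lem₂ : ∀ X b D t → X * (b * b * D) + b * b * t ≡ b * b * (X * D + t)
    lem₂ = solve 4 (λ X b D t → X :* (b :* b :* D) :+ b :* b :* t := b :* b :* (X :* D :+ t)) refl

  -- Growth inequality and harmonic numbers

  -- What `E-taylor` has in excess of the left side is `term n a` and the remainders, all
  -- nonnegative here.
  E-grow : ∀ n {a b} → 0ℚ ≤ a → 0ℚ ≤ a + b → (1ℚ + b) * E n a ≤ E (suc n) (a + b)
  E-grow n {a} {b} a≥0 c≥0 =
    ≤-by (0≤term n a≥0 ⊕ 0≤sum (λ k → 0≤remainder k a≥0 c≥0) n)
      (trans (E-taylor n a b) (trans (cong (λ u → u + b * E n a + s) (E-suc n a))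
        (lem (E n a) (term n a) b s)))
    where
    s : ℚ
    s = sum n (λ k → remainder k a b)
    lem : ∀ e t b s → (e + t) + b * e + s ≡ (1ℚ + b) * e + (t + s)
    lem = solve 4 (λ e t b s → e :+ t :+ b :* e :+ s := (con 1ℚ :+ b) :* e :+ (t :+ s)) refl

  -- The factor 1 + 1/(n + 1) takes n + 1 to n + 2 while the argument gains 1/(n + 1). The free `j`
  -- lets the number of terms be as large as a later convergence threshold asks.
  ⟦⟧≤E-H : ∀ n j → ⟦ suc n ⟧ ≤ E (n ℕ.+ suc j) (H n)
  ⟦⟧≤E-H zero    j = 1≤E-suc j ≤-refl
  ⟦⟧≤E-H (suc n) j = begin
    ⟦ suc (suc n) ⟧                              ≡⟨ ⟦⟧-suc (suc n) ⟩
    1ℚ + c                                       ≡⟨ cong (_+ c) (sym (⟦⟧-recip n)) ⟩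
    c * r + c                                    ≡⟨ lem₁ c r ⟩
    (1ℚ + r) * c
      ≤⟨ ≤-by ((0≤1 ⊕ 0≤recip n) ⊗ gap (⟦⟧≤E-H n j)) (lem₂ (1ℚ + r) c (E (n ℕ.+ suc j) (H n))) ⟩
    (1ℚ + r) * E (n ℕ.+ suc j) (H n)
      ≤⟨ E-grow (n ℕ.+ suc j) (0≤H n) (0≤H (suc n)) ⟩
    E (suc n ℕ.+ suc j) (H (suc n))              ∎
    where
    open ≤-Reasoning
    c r : ℚ
    c = ⟦ suc n ⟧
    r = recip n
    lem₁ : ∀ c r → c * r + c ≡ (1ℚ + r) * c
    lem₁ = solve 2 (λ c r → c :* r :+ c := (con 1ℚ :+ r) :* c) refl
    lem₂ : ∀ u c e → u * e ≡ u * c + u * (e - c)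
    lem₂ = solve 3 (λ u c e → u :* e := u :* c :+ u :* (e :- c)) refl

  -- Subtracting 1 makes the argument vanish at the bottom of the descent, where `E` is at most 1.
  -- The induction needs all `n` at once because each step down adds a term.
  E-H-1≤⟦⟧ : ∀ m n → E n (H (suc m) - 1ℚ) ≤ ⟦ suc m ⟧
  E-H-1≤⟦⟧ zero    zero    = ≤-trans (≤-reflexive (E-empty _)) 0≤1
  E-H-1≤⟦⟧ zero    (suc n) = ≤-reflexive (E-zero n)
  E-H-1≤⟦⟧ (suc m) n = *-cancelˡ-≤ (0<⟦suc⟧ m) (begin
    d * e                    ≡⟨ lem₁ d e ⟩
    (1ℚ + d) * e - 1ℚ * e
      ≡⟨ cong₂ (λ u v → u * e - v * e) (sym (⟦⟧-suc (suc m))) (sym (⟦⟧-recip (suc m))) ⟩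
    c * e - c * r * e        ≡⟨ lem₂ c r e ⟩
    c * ((1ℚ + - r) * e)
      ≤⟨ ≤-by (0≤⟦⟧ (suc (suc m)) ⊗ gap step) (lem₃ c _ d) ⟩
    c * d                    ≡⟨ *-comm c d ⟩
    d * c                    ∎)
    where
    open ≤-Reasoning
    c d r e : ℚ
    c = ⟦ suc (suc m) ⟧
    d = ⟦ suc m ⟧
    r = recip (suc m)
    e = E n (H (suc (suc m)) - 1ℚ)
    lem₁ : ∀ d e → d * e ≡ (1ℚ + d) * e - 1ℚ * e
    lem₁ = solve 2 (λ d e → d :* e := (con 1ℚ :+ d) :* e :- con 1ℚ :* e) refl
    lem₂ : ∀ c r e → c * e - c * r * e ≡ c * ((1ℚ + - r) * e)
    lem₂ = solve 3 (λ c r e → c :* e :- c :* r :* e := c :* ((con 1ℚ :+ (:- r)) :* e)) refl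
    lem₃ : ∀ c u d → c * d ≡ c * u + c * (d - u)
    lem₃ = solve 3 (λ c u d → c :* d := c :* u :+ c :* (d :- u)) refl
    lem₄ : ∀ h r → h + r - 1ℚ + - r ≡ h - 1ℚ
    lem₄ = solve 2 (λ h r → h :+ r :- con 1ℚ :+ (:- r) := h :- con 1ℚ) refl
    shift : H (suc (suc m)) - 1ℚ + - r ≡ H (suc m) - 1ℚ
    shift = lem₄ (H (suc m)) r
    step : (1ℚ + - r) * e ≤ d
    step = ≤-trans
      (E-grow n (gap (1≤H-suc (suc m))) (subst (0ℚ ≤_) (sym shift) (gap (1≤H-suc m))))
      (subst (λ x → E (suc n) x ≤ d) (sym shift) (E-H-1≤⟦⟧ m (suc n)))

  -- Going from `x` to `H (suc m) - 1ℚ` multiplies `E` by at least 1 + b, where b is the distance,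
  -- but by at most 4. As 1 + b is `H (suc m) - x`, this linear estimate already suffices and no
  -- logarithm of 4 enters.
  H-4≤ : ∀ m n {x} → 0ℚ ≤ x → ⟦ suc m ⟧ ≤ ⟦ 4 ⟧ * E (suc n) x → H (suc m) - ⟦ 4 ⟧ ≤ x
  H-4≤ m n {x} x≥0 h = ≤-by (gap b≤) (lem₂ x (H (suc m)))
    where
    open ≤-Reasoning
    b e : ℚ
    b = H (suc m) - 1ℚ - x
    e = E (suc n) x
    lem₁ : ∀ x h → x + (h - 1ℚ - x) ≡ h - 1ℚ
    lem₁ = solve 2 (λ x h → x :+ (h :- con 1ℚ :- x) := h :- con 1ℚ) refl
    lem₂ : ∀ x h → x ≡ h - (ℤ.+ 4 / 1) + ((ℤ.+ 4 / 1) - (1ℚ + (h - 1ℚ - x)))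
    lem₂ = solve 2 (λ x h →
      x := h :- con (ℤ.+ 4 / 1) :+ (con (ℤ.+ 4 / 1) :- (con 1ℚ :+ (h :- con 1ℚ :- x)))) refl
    shift : x + b ≡ H (suc m) - 1ℚ
    shift = lem₁ x (H (suc m))
    b≤ : 1ℚ + b ≤ ⟦ 4 ⟧
    b≤ = *-cancelˡ-≤ (<-≤-trans (positive⁻¹ 1ℚ) (1≤E-suc n x≥0)) (begin
      e * (1ℚ + b)                    ≡⟨ *-comm e (1ℚ + b) ⟩
      (1ℚ + b) * e
        ≤⟨ E-grow (suc n) x≥0 (subst (0ℚ ≤_) (sym shift) (gap (1≤H-suc m))) ⟩
      E (suc (suc n)) (x + b)         ≡⟨ cong (E (suc (suc n))) shift ⟩
      E (suc (suc n)) (H (suc m) - 1ℚ) ≤⟨ E-H-1≤⟦⟧ m (suc (suc n)) ⟩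
      ⟦ suc m ⟧                       ≤⟨ h ⟩
      ⟦ 4 ⟧ * e                       ≡⟨ *-comm ⟦ 4 ⟧ e ⟩
      e * ⟦ 4 ⟧                       ∎)

  ≤+4 : ∀ n {h c x} → 0ℚ ≤ h → 0ℚ < c → c ≤ E n h → 0ℚ ≤ x →
    E (suc n) x ≤ ⟦ 5 ⟧ * c → x ≤ h + ⟦ 4 ⟧
  ≤+4 n {h} {c} {x} h≥0 c>0 c≤e x≥0 bd with ≤-total x (h + ⟦ 4 ⟧)
  ... | inj₁ x≤ = x≤
  ... | inj₂ x≥ = ≤-by (gap b≤) (lem₂ x h)
    where
    open ≤-Reasoning
    b e : ℚ
    b = x - h
    e = E n h
    lem₁ : ∀ x h → h + (x - h) ≡ x
    lem₁ = solve 2 (λ x h → h :+ (x :- h) := x) refl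
    lem₂ : ∀ x h → h + (ℤ.+ 4 / 1) ≡ x + ((ℤ.+ 5 / 1) - (1ℚ + (x - h)))
    lem₂ = solve 2 (λ x h →
      h :+ con (ℤ.+ 4 / 1) := x :+ (con (ℤ.+ 5 / 1) :- (con 1ℚ :+ (x :- h)))) refl
    lem₃ : ∀ x h → 1ℚ + (x - h) ≡ (ℤ.+ 5 / 1) + (x - (h + (ℤ.+ 4 / 1)))
    lem₃ = solve 2 (λ x h →
      con 1ℚ :+ (x :- h) := con (ℤ.+ 5 / 1) :+ (x :- (h :+ con (ℤ.+ 4 / 1)))) refl
    lem₄ : ∀ c u e → u * e ≡ c * u + u * (e - c)
    lem₄ = solve 3 (λ c u e → u :* e := c :* u :+ u :* (e :- c)) refl
    -- This sign is what the case distinction provides: it allows `E n h` to be replaced by its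
    -- lower bound `c`.
    0≤1+b : 0ℚ ≤ 1ℚ + b
    0≤1+b = subst (0ℚ ≤_) (sym (lem₃ x h)) (0≤⟦⟧ 5 ⊕ gap x≥)
    shift : h + b ≡ x
    shift = lem₁ x h
    b≤ : 1ℚ + b ≤ ⟦ 5 ⟧
    b≤ = *-cancelˡ-≤ c>0 (begin
      c * (1ℚ + b)       ≤⟨ ≤-by (0≤1+b ⊗ gap c≤e) (lem₄ c (1ℚ + b) e) ⟩
      (1ℚ + b) * e       ≤⟨ E-grow n h≥0 (subst (0ℚ ≤_) (sym shift) x≥0) ⟩
      E (suc n) (h + b)  ≡⟨ cong (E (suc n)) shift ⟩
      E (suc n) x        ≤⟨ bd ⟩
      ⟦ 5 ⟧ * c          ≡⟨ *-comm ⟦ 5 ⟧ c ⟩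
      c * ⟦ 5 ⟧          ∎)

  ≤H+4 : ∀ m j {x} → 0ℚ ≤ x → E (suc (suc m ℕ.+ suc j)) x ≤ ⟦ 5 ⟧ * ⟦ suc m ⟧ →
    x ≤ H (suc m) + ⟦ 4 ⟧
  ≤H+4 m j x≥0 bd = ≤+4 (suc m ℕ.+ suc j) (0≤H (suc m)) (0<⟦suc⟧ m)
    (≤-trans (⟦⟧-mono (ℕ.n≤1+n (suc m))) (⟦⟧≤E-H (suc m) j)) x≥0 bd

  -- Quantitative injectivity of exp on [0, ∞): the slope there is at least 1, so an error in the
  -- values bounds the error in the arguments with constant 1.
  E-separates : ∀ n {x y η} → 0ℚ ≤ x → 0ℚ ≤ y → 0ℚ ≤ η →
    E (suc (suc n)) y ≤ E (suc n) x + η → y ≤ x + η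
  E-separates n {x} {y} {η} x≥0 y≥0 η≥0 h with ≤-total y x
  ... | inj₁ y≤x = ≤-trans y≤x (≤-by η≥0 refl)
  ... | inj₂ x≤y = ≤-by (gap h ⊕ gap grow ⊕ gap x≤y ⊗ gap (1≤E-suc n x≥0))
      (lem₂ x y η (E (suc n) x) (E (suc (suc n)) y))
    where
    lem₁ : ∀ x y → x + (y - x) ≡ y
    lem₁ = solve 2 (λ x y → x :+ (y :- x) := y) refl
    grow : (1ℚ + (y - x)) * E (suc n) x ≤ E (suc (suc n)) y
    grow = subst (λ z → (1ℚ + (y - x)) * E (suc n) x ≤ E (suc (suc n)) z) (lem₁ x y)
      (E-grow (suc n) x≥0 (subst (0ℚ ≤_) (sym (lem₁ x y)) y≥0))
    lem₂ : ∀ x y η e f → x + η ≡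
      y + ((e + η - f) + (f - (1ℚ + (y - x)) * e) + (y - x) * (e - 1ℚ))
    lem₂ = solve 5 (λ x y η e f →
      x :+ η := y :+ (e :+ η :- f :+ (f :- (con 1ℚ :+ (y :- x)) :* e) :+ (y :- x) :* (e
        :- con 1ℚ))) refl

  -- Exponential polynomials at negative arguments

  ∣sum-remainder∣≤ : ∀ n X → 0ℚ ≤ X → ∃[ D ] (0ℚ ≤ D × (∀ {a b} → ∣ a ∣ ≤ X → ∣ a + b ∣ ≤ X →
    ∣ sum n (λ k → remainder k a b) ∣ ≤ b * b * D))
  ∣sum-remainder∣≤ zero X X≥0 = 0ℚ , ≤-refl , λ {a} {b} _ _ → ≤-reflexive (sym (*-zeroʳ (b * b)))
  ∣sum-remainder∣≤ (suc n) X X≥0 with ∣sum-remainder∣≤ n X X≥0 | ∣remainder∣≤ n X X≥0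
  ... | D , D≥0 , p | D′ , D′≥0 , q = D + D′ , D≥0 ⊕ D′≥0 , λ {a} {b} ha hc →
    subst (∣ sum (suc n) (λ k → remainder k a b) ∣ ≤_) (sym (*-distribˡ-+ (b * b) D D′))
      (∣∣≤-+ (p {a} {b} ha hc) (q {a} {b} ha hc))

  -- The derivative `E n` is `E (suc n)` minus its last term. If that term is nonpositive at `a`,
  -- the derivative is at least `E (suc n) a`, and a step back by `h` contracts by 1 - h up to the
  -- Taylor error.
  E-decay : ∀ n {a h q} → 0ℚ ≤ h → 0ℚ ≤ - term n a →
    ∣ sum n (λ k → remainder k a (- h)) ∣ ≤ q → E (suc n) (a + - h) ≤ (1ℚ - h) * E (suc n) a + q
  E-decay n {a} {h} {q} h≥0 t≤0 bd = subst₂ _≤_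
    (sym (trans (E-taylor n a (- h)) (cong (λ u → u + - h * E n a + s) (E-suc n a))))
    (cong (λ u → (1ℚ - h) * u + q) (sym (E-suc n a)))
    (≤-by (h≥0 ⊗ t≤0 ⊕ gap (∣p∣≤⇒p≤ bd)) (lem (E n a) (term n a) h s q))
    where
    s : ℚ
    s = sum n (λ k → remainder k a (- h))
    lem : ∀ e t h s q → (1ℚ - h) * (e + t) + q ≡ (e + t) + - h * e + s + (h * - t + (q - s))
    lem = solve 5 (λ e t h s q →
      (con 1ℚ :- h) :* (e :+ t) :+ q := e :+ t :+ (:- h) :* e :+ s :+ (h :* (:- t) :+ (q
        :- s))) refl

  -- A discrete Gronwall estimate: the contraction preserves the bound 1 and the errors only add up.
  -- With steps of length X/M the error `q` is of order 1/M², so the total M q is at most 1 for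
  -- large M.
  decay-bound : ∀ (f : ℕ → ℚ) M {h q} → 0ℚ ≤ h → h ≤ 1ℚ → 0ℚ ≤ q → f 0 ≤ 1ℚ →
    (∀ j → j ℕ.< M → f (suc j) ≤ (1ℚ - h) * f j + q) → ∀ j → j ℕ.≤ M → f j ≤ 1ℚ + ⟦ j ⟧ * q
  decay-bound f M {h} {q} h≥0 h≤1 q≥0 base step zero _ = ≤-trans base
    (≤-by (0≤⟦⟧ 0 ⊗ q≥0) refl)
  decay-bound f M {h} {q} h≥0 h≤1 q≥0 base step (suc j) j<M = begin
    f (suc j)
      ≤⟨ step j j<M ⟩
    (1ℚ - h) * f j + q
      ≤⟨ ≤-by (gap h≤1 ⊗ gap (decay-bound f M h≥0 h≤1 q≥0 base step j (ℕ.<⇒≤ j<M))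
                ⊕ h≥0 ⊗ (0≤1 ⊕ 0≤⟦⟧ j ⊗ q≥0)) (lem h (f j) ⟦ j ⟧ q) ⟩
    1ℚ + (1ℚ + ⟦ j ⟧) * q
      ≡⟨ cong (λ c → 1ℚ + c * q) (sym (⟦⟧-suc j)) ⟩
    1ℚ + ⟦ suc j ⟧ * q ∎
    where
    open ≤-Reasoning
    lem : ∀ h f j q → 1ℚ + (1ℚ + j) * q ≡
      ((1ℚ - h) * f + q) + ((1ℚ - h) * (1ℚ + j * q - f) + h * (1ℚ + j * q))
    lem = solve 4 (λ h f j q →
      con 1ℚ :+ (con 1ℚ :+ j) :* q := (con 1ℚ :- h) :* f :+ q :+ ((con 1ℚ :- h) :* (con 1ℚ
        :+ j :* q :- f) :+ h :* (con 1ℚ :+ j :* q))) refl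

  -- Euler's method for f(t) = E (2k+2) (−t), which satisfies f′ ≤ −f because its last term is
  -- negative; the step errors are quadratic in h.
  E-neg : ∀ k {x} → 0ℚ ≤ x → E (suc (suc (k ℕ.+ k))) (- x) ≤ ⟦ 2 ⟧
  E-neg k {X} X≥0 with ∣sum-remainder∣≤ (suc (k ℕ.+ k)) X X≥0
  ... | D , D≥0 , bd with archimedean (X + X * X * D)
  ... | m , m≥ = ≤-trans
      (subst (λ y → E (suc n) (- y) ≤ 1ℚ + M * q) Mh≡X
        (decay-bound f (suc m) h≥0 h≤1 q≥0 base step (suc m) ℕ.≤-refl))
      (≤-by (gap Mq≤1) (lem M q))
    where
    n = suc (k ℕ.+ k)
    M h q : ℚ
    M = ⟦ suc m ⟧
    h = X * recip m
    q = - h * - h * D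
    f : ℕ → ℚ
    f j = E (suc n) (- (⟦ j ⟧ * h))
    lem : ∀ M q → (ℤ.+ 2 / 1) ≡ (1ℚ + M * q) + (1ℚ - M * q)
    lem = solve 2 (λ M q → con (ℤ.+ 2 / 1) := con 1ℚ :+ M :* q :+ (con 1ℚ :- M :* q)) refl
    h≥0 : 0ℚ ≤ h
    h≥0 = X≥0 ⊗ 0≤recip m
    q≥0 : 0ℚ ≤ q
    q≥0 = 0≤p*p (- h) ⊗ D≥0
    Mh≡X : M * h ≡ X
    Mh≡X = trans (lem′ M X (recip m)) (trans (cong (X *_) (⟦⟧-recip m)) (*-identityʳ X))
      where
      lem′ : ∀ M X r → M * (X * r) ≡ X * (M * r)
      lem′ = solve 3 (λ M X r → M :* (X :* r) := X :* (M :* r)) refl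
    X+XXD≤M : X + X * X * D ≤ M
    X+XXD≤M = ≤-trans m≥ (⟦⟧-mono (ℕ.n≤1+n m))
    h≤1 : h ≤ 1ℚ
    h≤1 = *-cancelˡ-≤ (0<⟦suc⟧ m) (subst₂ _≤_ (sym Mh≡X) (sym (*-identityʳ M))
      (≤-trans (≤-by (X≥0 ⊗ X≥0 ⊗ D≥0) refl) X+XXD≤M))
    Mq≤1 : M * q ≤ 1ℚ
    Mq≤1 = *-cancelˡ-≤ (0<⟦suc⟧ m) (begin
      M * (M * q)           ≡⟨ lem′ M h D ⟩
      (M * h) * (M * h) * D ≡⟨ cong (λ t → t * t * D) Mh≡X ⟩
      X * X * D             ≤⟨ ≤-by X≥0 (+-comm X (X * X * D)) ⟩
      X + X * X * D         ≤⟨ X+XXD≤M ⟩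
      M                     ≡⟨ sym (*-identityʳ M) ⟩
      M * 1ℚ                ∎)
      where
      open ≤-Reasoning
      lem′ : ∀ M h D → M * (M * (- h * - h * D)) ≡ (M * h) * (M * h) * D
      lem′ = solve 3 (λ M h D → M :* (M :* ((:- h) :* (:- h) :* D)) := M :* h :* (M :* h) :* D) refl
    base : f 0 ≤ 1ℚ
    base = ≤-reflexive (trans (cong (λ y → E (suc n) (- y)) zero-h) (E-zero n))
      where
      zero-h : ⟦ 0 ⟧ * h ≡ 0ℚ
      zero-h = *-zeroˡ h
    grid : ∀ j → j ℕ.≤ suc m → ∣ - (⟦ j ⟧ * h) ∣ ≤ X
    grid j j≤ = ∣∣≤-neg {⟦ j ⟧ * h} (subst (_≤ X) (sym (0≤p⇒∣p∣≡p (0≤⟦⟧ j ⊗ h≥0)))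
      (subst (⟦ j ⟧ * h ≤_) Mh≡X (*-monoʳ-≤-nonNeg h {{nonNegative h≥0}} (⟦⟧-mono j≤))))
    step : ∀ j → j ℕ.< suc m → f (suc j) ≤ (1ℚ - h) * f j + q
    step j j<M = subst (λ y → E (suc n) y ≤ (1ℚ - h) * f j + q) (sym next)
      (E-decay n {a} {h} {q} h≥0 (term-odd-nonPos k (0≤⟦⟧ j ⊗ h≥0))
        (bd {a} { - h} (grid j (ℕ.<⇒≤ j<M)) (subst (λ y → ∣ y ∣ ≤ X) next (grid (suc j) j<M))))
      where
      a : ℚ
      a = - (⟦ j ⟧ * h)
      lem′ : ∀ j h → - ((1ℚ + j) * h) ≡ - (j * h) + - h
      lem′ = solve 2 (λ j h → :- ((con 1ℚ :+ j) :* h) := :- (j :* h) :+ (:- h)) refl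
      next : - (⟦ suc j ⟧ * h) ≡ a + - h
      next = trans (cong (λ c → - (c * h)) (⟦⟧-suc j)) (lem′ ⟦ j ⟧ h)

  -- Dilogarithm polynomials

  -- The factor 1ℚ makes this equal, by computation, to the coefficient (1/suc k) ^ 2 of Li₂.
  weight : ℕ → ℚ
  weight k = recip k * (recip k * 1ℚ)

  opaque
    Li : ℕ → ℚ → ℚ
    Li n x = sum n (λ k → pow x (suc k) * weight k)

    drop : ℕ → ℚ → ℚ → ℚ
    drop k e q = (1ℚ - pow (1ℚ - e) (suc k)) * pow q (suc k) * weight k

    LiDrop : ℕ → ℚ → ℚ → ℚ
    LiDrop n e q = sum n (λ k → drop k e q)

    Li-def : ∀ n x → Li n x ≡ sum n (λ k → pow x (suc k) * weight k)
    Li-def n x = refl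

    LiDrop-zero : ∀ e q → LiDrop 0 e q ≡ 0ℚ
    LiDrop-zero e q = refl

    LiDrop-suc : ∀ n e q → LiDrop (suc n) e q ≡ LiDrop n e q + drop n e q
    LiDrop-suc n e q = refl

    drop-def : ∀ k e q → drop k e q ≡ (1ℚ - pow (1ℚ - e) (suc k)) * pow q (suc k) * weight k
    drop-def k e q = refl

    Li-LiDrop : ∀ n e q → Li n q - Li n ((1ℚ - e) * q) ≡ LiDrop n e q
    Li-LiDrop zero    e q = refl
    Li-LiDrop (suc n) e q = trans
      (cong (λ u → (Li n q + p * w) - (Li n ((1ℚ - e) * q) + u * w)) (pow-* (1ℚ - e) q (suc n)))
      (trans (lem (Li n q) (Li n ((1ℚ - e) * q)) (pow (1ℚ - e) (suc n)) p w)
        (cong (_+ drop n e q) (Li-LiDrop n e q)))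
      where
      p w : ℚ
      p = pow q (suc n)
      w = weight n
      lem : ∀ l l′ z p w → (l + p * w) - (l′ + z * p * w) ≡ (l - l′) + (1ℚ - z) * p * w
      lem = solve 5 (λ l l′ z p w →
        l :+ p :* w :- (l′ :+ z :* p :* w) := l :- l′ :+ (con 1ℚ :- z) :* p :* w) refl

  weight-≡ : ∀ k → ⟦ suc k ⟧ * weight k ≡ recip k
  weight-≡ k = trans (lem ⟦ suc k ⟧ (recip k))
    (trans (cong (_* recip k) (⟦⟧-recip k)) (*-identityˡ (recip k)))
    where
    lem : ∀ c r → c * (r * (r * 1ℚ)) ≡ c * r * r
    lem = solve 2 (λ c r → c :* (r :* (r :* con 1ℚ)) := c :* r :* r) refl

  0≤weight : ∀ k → 0ℚ ≤ weight k
  0≤weight k = 0≤recip k ⊗ (0≤recip k ⊗ 0≤1)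

  -- Makes the tail of the sum of 1/k² telescope.
  weight-≤ : ∀ k → weight (suc k) ≤ recip k - recip (suc k)
  weight-≤ k = ≤-by (gap (recip-anti k) ⊗ 0≤recip (suc k))
    (trans (sym (recip-telescope k)) (lem (recip k) (recip (suc k))))
    where
    lem : ∀ r s → r * s ≡ s * (s * 1ℚ) + (r - s) * s
    lem = solve 2 (λ r s → r :* s := s :* (s :* con 1ℚ) :+ (r :- s) :* s) refl

  pow≤1 : ∀ {z} → 0ℚ ≤ z → z ≤ 1ℚ → ∀ n → pow z n ≤ 1ℚ
  pow≤1 z≥0 z≤1 zero = ≤-refl
  pow≤1 {z} z≥0 z≤1 (suc n) = ≤-by (gap z≤1 ⊕ z≥0 ⊗ gap (pow≤1 z≥0 z≤1 n)) (lem z (pow z n))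
    where
    lem : ∀ z p → 1ℚ ≡ z * p + ((1ℚ - z) + z * (1ℚ - p))
    lem = solve 2 (λ z p → con 1ℚ := z :* p :+ (con 1ℚ :- z :+ z :* (con 1ℚ :- p))) refl

  -- Bounds for the change of the dilogarithm polynomials from q to (1 - e)q

  module _ {e : ℚ} (e≥0 : 0ℚ ≤ e) (e≤1 : e ≤ 1ℚ) where
    private
      z : ℚ
      z = 1ℚ - e

      z≥0 : 0ℚ ≤ z
      z≥0 = gap e≤1

      z≤1 : z ≤ 1ℚ
      z≤1 = ≤-by e≥0 (lem e)
        where
        lem : ∀ e → 1ℚ ≡ (1ℚ - e) + e
        lem = solve 1 (λ e → con 1ℚ := con 1ℚ :- e :+ e) refl

    1-pow≤ : ∀ n → 1ℚ - pow z n ≤ ⟦ n ⟧ * e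
    1-pow≤ zero    = ≤-reflexive (sym (*-zeroˡ e))
    1-pow≤ (suc n) = subst (λ c → 1ℚ - pow z (suc n) ≤ c * e) (sym (⟦⟧-suc n))
      (≤-by (gap (1-pow≤ n) ⊕ e≥0 ⊗ gap (pow≤1 z≥0 z≤1 n)) (lem ⟦ n ⟧ e (pow z n)))
      where
      lem : ∀ c e p → (1ℚ + c) * e ≡ (1ℚ - (1ℚ - e) * p) + ((c * e - (1ℚ - p)) + e * (1ℚ - p))
      lem = solve 3 (λ c e p →
        (con 1ℚ :+ c) :* e := con 1ℚ :- (con 1ℚ :- e) :* p :+ (c :* e :- (con 1ℚ :- p)
          :+ e :* (con 1ℚ :- p))) refl

    -- The second-order companion of Bernoulli's inequality `1-pow≤`. The crude n² in place of n(n -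
    -- 1)/2 is harmless: against the weight 1/n² it costs e² per term, hence O(e) over about 1/e
    -- terms.
    ≤1-pow : ∀ n → ⟦ n ⟧ * e - ⟦ n ⟧ * ⟦ n ⟧ * (e * e) ≤ 1ℚ - pow z n
    ≤1-pow zero    = ≤-reflexive (lem e)
      where
      lem : ∀ e → 0ℚ * e - 0ℚ * 0ℚ * (e * e) ≡ 0ℚ
      lem = solve 1 (λ e → con 0ℚ :* e :- con 0ℚ :* con 0ℚ :* (e :* e) := con 0ℚ) refl
    ≤1-pow (suc n) = subst (λ c → c * e - c * c * (e * e) ≤ 1ℚ - pow z (suc n)) (sym (⟦⟧-suc n))
      (≤-by (gap (≤1-pow n) ⊕ e≥0 ⊗ gap (1-pow≤ n) ⊕ (0≤⟦⟧ n ⊕ 0≤1) ⊗ 0≤p*p e)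
        (lem ⟦ n ⟧ e (pow z n)))
      where
      lem : ∀ c e p → 1ℚ - (1ℚ - e) * p ≡
        ((1ℚ + c) * e - (1ℚ + c) * (1ℚ + c) * (e * e)) +
        (((1ℚ - p) - (c * e - c * c * (e * e))) + e * (c * e - (1ℚ - p)) + (c + 1ℚ) * (e * e))
      lem = solve 3 (λ c e p →
        con 1ℚ :- (con 1ℚ :- e) :* p := (con 1ℚ :+ c) :* e :- (con 1ℚ :+ c) :* (con 1ℚ
          :+ c) :* (e :* e) :+ (con 1ℚ :- p :- (c :* e :- c :* c :* (e :* e)) :+ e :* (c :* e
          :- (con 1ℚ :- p)) :+ (c :+ con 1ℚ) :* (e :* e))) refl

    drop≤ : ∀ k {q} → 0ℚ ≤ q → drop k e q ≤ e * recip k * pow q (suc k)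
    drop≤ k {q} q≥0 = subst (_≤ e * recip k * p) (sym (drop-def k e q))
      (≤-by (gap (1-pow≤ (suc k)) ⊗ 0≤pow q≥0 (suc k) ⊗ 0≤weight k)
        (trans (cong (λ r → e * r * p) (sym (weight-≡ k)))
          (lem ⟦ suc k ⟧ e (pow z (suc k)) p (weight k))))
      where
      p : ℚ
      p = pow q (suc k)
      lem : ∀ c e z p w → e * (c * w) * p ≡ (1ℚ - z) * p * w + (c * e - (1ℚ - z)) * p * w
      lem = solve 5 (λ c e z p w →
        e :* (c :* w) :* p := (con 1ℚ :- z) :* p :* w :+ (c :* e :- (con 1ℚ :- z)) :* p :* w) refl

    0≤drop : ∀ k {q} → 0ℚ ≤ q → 0ℚ ≤ drop k e q
    0≤drop k {q} q≥0 = subst (0ℚ ≤_) (sym (drop-def k e q))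
      (gap (pow≤1 z≥0 z≤1 (suc k)) ⊗ 0≤pow q≥0 (suc k) ⊗ 0≤weight k)

    drop-one : ∀ k → drop k e 1ℚ ≡ (1ℚ - pow z (suc k)) * weight k
    drop-one k = trans (drop-def k e 1ℚ) (trans
      (cong (λ p → (1ℚ - pow z (suc k)) * p * weight k) (pow-1 (suc k)))
      (cong (_* weight k) (*-identityʳ (1ℚ - pow z (suc k)))))

    drop-one-≤weight : ∀ k → drop k e 1ℚ ≤ weight k
    drop-one-≤weight k = subst (_≤ weight k) (sym (drop-one k))
      (≤-by (0≤pow z≥0 (suc k) ⊗ 0≤weight k) (lem (pow z (suc k)) (weight k)))
      where
      lem : ∀ p w → w ≡ (1ℚ - p) * w + p * w
      lem = solve 2 (λ p w → w := (con 1ℚ :- p) :* w :+ p :* w) refl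

    ≤drop-one : ∀ k → e * recip k - e * e ≤ drop k e 1ℚ
    ≤drop-one k = subst (e * recip k - e * e ≤_) (sym (drop-one k))
      (≤-by (gap (≤1-pow (suc k)) ⊗ 0≤weight k)
        (lem {⟦ suc k ⟧} {pow z (suc k)} {weight k} (weight-≡ k) (trans (*-assoc ⟦ suc k ⟧ ⟦ suc k ⟧ (weight k))
          (trans (cong (⟦ suc k ⟧ *_) (weight-≡ k)) (⟦⟧-recip k)))))
      where
      lem₁ : ∀ c e p w → (1ℚ - p) * w ≡
        (e * (c * w) - e * e * (c * c * w)) + ((1ℚ - p) - (c * e - c * c * (e * e))) * w
      lem₁ = solve 4 (λ c e p w →
        (con 1ℚ :- p) :* w := e :* (c :* w) :- e :* e :* (c :* c :* w) :+ (con 1ℚ :- p :- (c :* e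
          :- c :* c :* (e :* e))) :* w) refl
      lem : ∀ {c p w r} → c * w ≡ r → c * c * w ≡ 1ℚ →
        (1ℚ - p) * w ≡ (e * r - e * e) + ((1ℚ - p) - (c * e - c * c * (e * e))) * w
      lem {c} {p} {w} {r} h₁ h₂ = trans (lem₁ c e p w)
        (cong (_+ ((1ℚ - p) - (c * e - c * c * (e * e))) * w)
          (cong₂ _-_ (cong (e *_) h₁) (trans (cong (e * e *_) h₂) (*-identityʳ (e * e)))))

    LiDrop-mono : ∀ j n {q} → 0ℚ ≤ q → LiDrop n e q ≤ LiDrop (j ℕ.+ n) e q
    LiDrop-mono zero    n q≥0 = ≤-refl
    LiDrop-mono (suc j) n {q} q≥0 = ≤-trans (LiDrop-mono j n q≥0)
      (≤-by (0≤drop (j ℕ.+ n) q≥0) (LiDrop-suc (j ℕ.+ n) e q))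

    LiDrop-one-≤H : ∀ n → LiDrop n e 1ℚ ≤ e * H n
    LiDrop-one-≤H zero    = ≤-reflexive (trans (LiDrop-zero e 1ℚ) (sym (*-zeroʳ e)))
    LiDrop-one-≤H (suc n) = subst₂ _≤_ (sym (LiDrop-suc n e 1ℚ)) (sym (*-distribˡ-+ e (H n) (recip n)))
      (+-mono-≤ (LiDrop-one-≤H n) (subst (drop n e 1ℚ ≤_)
        (trans (cong (e * recip n *_) (pow-1 (suc n))) (*-identityʳ (e * recip n))) (drop≤ n 0≤1)))

    LiDrop-one-≤ : ∀ m j →
      LiDrop (j ℕ.+ suc m) e 1ℚ ≤ e * H (suc m) + (recip m - recip (j ℕ.+ m))
    LiDrop-one-≤ m zero = ≤-trans (LiDrop-one-≤H (suc m)) (≤-reflexive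
      (lem (e * H (suc m)) (recip m)))
      where
      lem : ∀ u r → u ≡ u + (r - r)
      lem = solve 2 (λ u r → u := u :+ (r :- r)) refl
    LiDrop-one-≤ m (suc j) = subst (_≤ e * H (suc m) + (recip m - recip (suc j ℕ.+ m)))
      (sym (LiDrop-suc (j ℕ.+ suc m) e 1ℚ))
      (≤-trans (+-mono-≤ (LiDrop-one-≤ m j) (≤-trans (drop-one-≤weight (j ℕ.+ suc m))
          (subst (λ i → weight i ≤ recip (j ℕ.+ m) - recip (suc j ℕ.+ m)) (sym (ℕ.+-suc j m))
            (weight-≤ (j ℕ.+ m)))))
        (≤-reflexive (lem (e * H (suc m)) (recip m) (recip (j ℕ.+ m)) (recip (suc j ℕ.+ m)))))
      where
      lem : ∀ u r s t → (u + (r - s)) + (s - t) ≡ u + (r - t)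
      lem = solve 4 (λ u r s t → u :+ (r :- s) :+ (s :- t) := u :+ (r :- t)) refl

    ≤LiDrop-one : ∀ n → e * H n - ⟦ n ⟧ * (e * e) ≤ LiDrop n e 1ℚ
    ≤LiDrop-one zero    = ≤-reflexive (trans (lem e) (sym (LiDrop-zero e 1ℚ)))
      where
      lem : ∀ e → e * 0ℚ - 0ℚ * (e * e) ≡ 0ℚ
      lem = solve 1 (λ e → e :* con 0ℚ :- con 0ℚ :* (e :* e) := con 0ℚ) refl
    ≤LiDrop-one (suc n) = subst₂ _≤_
      (trans (lem e (H n) ⟦ n ⟧ (recip n)) (cong (λ c → e * H (suc n) - c * (e * e)) (sym (⟦⟧-suc n))))
      (sym (LiDrop-suc n e 1ℚ))
      (+-mono-≤ (≤LiDrop-one n) (≤drop-one n))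
      where
      lem : ∀ e h c r → (e * h - c * (e * e)) + (e * r - e * e) ≡ e * (h + r) - (1ℚ + c) * (e * e)
      lem = solve 4 (λ e h c r →
        e :* h :- c :* (e :* e) :+ (e :* r :- e :* e) := e :* (h :+ r) :- (con 1ℚ
          :+ c) :* (e :* e)) refl

    -- Cutting the sum at m + 1 ≈ 1/e: below, 1 − zᵏ ≈ k e; above, 1 − zᵏ ≤ 1.
    ∣LiDrop-one-eH∣≤ : ∀ m j → 1ℚ ≤ ⟦ 4 ⟧ * (⟦ suc m ⟧ * e) → ⟦ suc m ⟧ * e ≤ ⟦ 2 ⟧ →
      ∣ LiDrop (j ℕ.+ suc m) e 1ℚ - e * H (suc m) ∣ ≤ ⟦ 4 ⟧ * e
    ∣LiDrop-one-eH∣≤ m j 1≤4ce ce≤2 = ∣∣≤-intro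
      (≤-by (gap (LiDrop-one-≤ m j) ⊕ 0≤recip (j ℕ.+ m) ⊕ gap r≤4e)
        (lem₁ d u (recip m) (recip (j ℕ.+ m)) (⟦ 4 ⟧ * e)))
      (≤-by (gap (≤-trans (≤LiDrop-one (suc m)) (LiDrop-mono j (suc m) 0≤1))
          ⊕ gap ce≤2 ⊗ e≥0 ⊕ 0≤⟦⟧ 2 ⊗ e≥0)
        (lem₂ d u ⟦ suc m ⟧ e))
      where
      d u : ℚ
      d = LiDrop (j ℕ.+ suc m) e 1ℚ
      u = e * H (suc m)
      lem₁ : ∀ d u r s t → t ≡ (d - u) + (((u + (r - s)) - d) + s + (t - r))
      lem₁ = solve 5 (λ d u r s t → t := d :- u :+ (u :+ (r :- s) :- d :+ s :+ (t :- r))) refl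
      lem₂ : ∀ d u c e → (ℤ.+ 4 / 1) * e ≡ - (d - u) +
        ((d - (u - c * (e * e))) + ((ℤ.+ 2 / 1) - c * e) * e + (ℤ.+ 2 / 1) * e)
      lem₂ = solve 4 (λ d u c e →
        con (ℤ.+ 4 / 1) :* e := :- (d :- u) :+ (d :- (u :- c :* (e :* e)) :+ (con (ℤ.+ 2 / 1)
          :- c :* e) :* e :+ con (ℤ.+ 2 / 1) :* e)) refl
      lem₃ : ∀ f c e r → f * (c * e) * r ≡ f * e * (c * r)
      lem₃ = solve 4 (λ f c e r → f :* (c :* e) :* r := f :* e :* (c :* r)) refl
      lem₄ : ∀ t r → t * r ≡ r + (t - 1ℚ) * r
      lem₄ = solve 2 (λ t r → t :* r := r :+ (t :- con 1ℚ) :* r) refl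
      r≤4e : recip m ≤ ⟦ 4 ⟧ * e
      r≤4e = ≤-trans (≤-by (gap 1≤4ce ⊗ 0≤recip m) (lem₄ (⟦ 4 ⟧ * (⟦ suc m ⟧ * e)) (recip m)))
        (≤-reflexive (trans (lem₃ ⟦ 4 ⟧ ⟦ suc m ⟧ e (recip m))
          (trans (cong (⟦ 4 ⟧ * e *_) (⟦⟧-recip m)) (*-identityʳ (⟦ 4 ⟧ * e)))))

    -- The term k = 1 is exactly e q, and those with k ≥ 2 are at most e qᵏ. Since g(1 - q) = q²,
    -- `g` is the full geometric tail q² + q³ + ..., and `g * pow q j` is its part not yet summed.
    LiDrop-recip-≤ : ∀ m j → let q = recip (suc m); g = recip m * q in
      LiDrop (suc j) e q ≤ e * q + e * (g - g * pow q j)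
    LiDrop-recip-≤ m zero = ≤-reflexive (trans (LiDrop-suc 0 e q) (trans
        (cong₂ _+_ (LiDrop-zero e q) (drop-def 0 e q)) (lem e q (recip m * q))))
      where
      q : ℚ
      q = recip (suc m)
      lem : ∀ e q g → 0ℚ + (1ℚ - (1ℚ - e) * 1ℚ) * (q * 1ℚ) * 1ℚ ≡ e * q + e * (g - g * 1ℚ)
      lem = solve 3 (λ e q g →
        con 0ℚ :+ (con 1ℚ :- (con 1ℚ :- e) :* con 1ℚ) :* (q :* con 1ℚ) :* con 1ℚ := e :* q
          :+ e :* (g :- g :* con 1ℚ)) refl
    LiDrop-recip-≤ m (suc j) = subst (_≤ e * q + e * (g - g * (q * p)))
      (sym (LiDrop-suc (suc j) e q))
      (≤-trans (+-mono-≤ (LiDrop-recip-≤ m j) (≤-trans (drop≤ (suc j) q≥0)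
          (≤-by (e≥0 ⊗ gap (recip≤1 (suc j)) ⊗ (q≥0 ⊗ (q≥0 ⊗ 0≤pow q≥0 j))) (lem₁ e (recip (suc j)) (q * (q * p))))))
        (≤-reflexive (trans (lem₂ e q g p) (trans
          (cong (λ s → e * q + e * (g - g * p + s * p)) (sym gq)) (lem₃ e q g p)))))
      where
      q r g p : ℚ
      q = recip (suc m)
      r = recip m
      g = r * q
      p = pow q j
      q≥0 : 0ℚ ≤ q
      q≥0 = 0≤recip (suc m)
      lem₁ : ∀ e r p → e * p ≡ e * r * p + e * (1ℚ - r) * p
      lem₁ = solve 3 (λ e r p → e :* p := e :* r :* p :+ e :* (con 1ℚ :- r) :* p) refl
      lem₂ : ∀ e q g p → (e * q + e * (g - g * p)) + e * (q * (q * p)) ≡ e * q + e * (g - g * p + q * q * p)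
      lem₂ = solve 4 (λ e q g p →
        e :* q :+ e :* (g :- g :* p) :+ e :* (q :* (q :* p)) := e :* q :+ e :* (g :- g :* p
          :+ q :* q :* p)) refl
      lem₃ : ∀ e q g p → e * q + e * (g - g * p + g * (1ℚ - q) * p) ≡ e * q + e * (g - g * (q * p))
      lem₃ = solve 4 (λ e q g p →
        e :* q :+ e :* (g :- g :* p :+ g :* (con 1ℚ :- q) :* p) := e :* q :+ e :* (g
          :- g :* (q :* p))) refl
      lem₄ : ∀ r q → r * q * (1ℚ - q) ≡ q * (r - r * q)
      lem₄ = solve 2 (λ r q → r :* q :* (con 1ℚ :- q) := q :* (r :- r :* q)) refl
      lem₅ : ∀ r q → q * (r - (r - q)) ≡ q * q
      lem₅ = solve 2 (λ r q → q :* (r :- (r :- q)) := q :* q) refl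
      gq : g * (1ℚ - q) ≡ q * q
      gq = trans (lem₄ r q) (trans (cong (λ s → q * (r - s)) (recip-telescope m)) (lem₅ r q))

    -- The bound e/((m + 1)(m + 2)) is stated as a difference so that the sum over `m` telescopes to
    -- at most e.
    ∣LiDrop-recip-eq∣≤ : ∀ m j → let q = recip (suc m) in
      ∣ LiDrop (suc j) e q - e * q ∣ ≤ e * (recip m - q)
    ∣LiDrop-recip-eq∣≤ m j = subst (λ s → ∣ d - e * q ∣ ≤ e * s) (recip-telescope m)
      (∣∣≤-intro
        (≤-by (gap (LiDrop-recip-≤ m j) ⊕ e≥0 ⊗ (g≥0 ⊗ 0≤pow q≥0 j)) (lem₁ d e q g (pow q j)))
        (≤-by (gap first ⊕ e≥0 ⊗ g≥0) (lem₂ d e q g)))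
      where
      q g d : ℚ
      q = recip (suc m)
      g = recip m * q
      d = LiDrop (suc j) e q
      q≥0 : 0ℚ ≤ q
      q≥0 = 0≤recip (suc m)
      g≥0 : 0ℚ ≤ g
      g≥0 = 0≤recip m ⊗ q≥0
      lem₁ : ∀ d e q g p → e * g ≡ (d - e * q) + ((e * q + e * (g - g * p) - d) + e * (g * p))
      lem₁ = solve 5 (λ d e q g p →
        e :* g := d :- e :* q :+ (e :* q :+ e :* (g :- g :* p) :- d :+ e :* (g :* p))) refl
      lem₂ : ∀ d e q g → e * g ≡ - (d - e * q) + ((d - e * q) + e * g)
      lem₂ = solve 4 (λ d e q g → e :* g := :- (d :- e :* q) :+ (d :- e :* q :+ e :* g)) refl
      lem₃ : ∀ e q → e * q ≡ 0ℚ + (1ℚ - (1ℚ - e) * 1ℚ) * (q * 1ℚ) * 1ℚ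
      lem₃ = solve 2 (λ e q →
        e :* q := con 0ℚ :+ (con 1ℚ :- (con 1ℚ :- e) :* con 1ℚ) :* (q :* con 1ℚ) :* con 1ℚ) refl
      first : e * q ≤ d
      first = subst₂ _≤_ (trans (LiDrop-suc 0 e q) (trans
          (cong₂ _+_ (LiDrop-zero e q) (drop-def 0 e q)) (sym (lem₃ e q))))
        (cong (λ i → LiDrop i e q) (ℕ.+-comm j 1))
        (LiDrop-mono j 1 q≥0)

  -- Limits of reals, on representatives

  Eventually : (ℕ → Set) → Set
  Eventually P = ∃[ N ] (∀ n → N ℕ.≤ n → P n)

  mapᵉ : ∀ {P Q : ℕ → Set} → (∀ n → P n → Q n) → Eventually P → Eventually Q
  mapᵉ f (N , p) = N , λ n N≤n → f n (p n N≤n)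

  infixr 4 _&_
  _&_ : ∀ {P Q : ℕ → Set} → Eventually P → Eventually Q → Eventually (λ n → P n × Q n)
  (M , p) & (N , q) = M ℕ.⊔ N , λ n h →
    p n (ℕ.m⊔n≤o⇒m≤o M N h) , q n (ℕ.m⊔n≤o⇒n≤o M N h)

  ½*-pos : ∀ {η} → 0ℚ < η → 0ℚ < ½ * η
  ½*-pos = *-pos 0<½

  ½+½ : ∀ η → ½ * η + ½ * η ≡ η
  ½+½ = solve 1 (λ η → con ½ :* η :+ con ½ :* η := η) refl

  -- Half of η pays for the limit, the other half for the slack in the order of the reals. The
  -- threshold for `m` depends on `n`.
  ⟶⇒termwise : ∀ s x → s ⟶ x → ∀ η → 0ℚ < η →
    Eventually (λ n → Eventually (λ m → ∣ seq (s n) m - seq x m ∣ ≤ η))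
  ⟶⇒termwise s x lim η η>0 = mapᵉ
    (λ n close → mapᵉ (λ m → subst (∣ seq (s n) m - seq x m ∣ ≤_) (½+½ η))
      (close (½ * η) (½*-pos η>0)))
    (lim (½ * η) (½*-pos η>0))

  seq-∑ : ∀ n f m → seq (∑< n f) m ≡ sum n (λ k → seq (f k) m)
  seq-∑ zero    f m = refl
  seq-∑ (suc n) f m = cong (_+ seq (f n) m) (seq-∑ n f m)

  seq-^ : ∀ x n m → seq (x R.^ n) m ≡ pow (seq x m) n
  seq-^ x zero    m = refl
  seq-^ x (suc n) m = cong (seq x m *_) (seq-^ x n m)

  Exp⇒E : ∀ x y → Exp x y → ∀ η → 0ℚ < η →
    Eventually (λ n → Eventually (λ m → ∣ E n (seq x m) - seq y m ∣ ≤ η))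
  Exp⇒E x y e η η>0 = mapᵉ
    (λ n → mapᵉ (λ m → subst (λ u → ∣ u - seq y m ∣ ≤ η) (partial n m)))
    (⟶⇒termwise (λ n → ∑< n (λ k → x R.^ k R.* R.1/! k)) y e η η>0)
    where
    partial : ∀ n m → seq (∑< n (λ k → x R.^ k R.* R.1/! k)) m ≡ E n (seq x m)
    partial n m = trans (seq-∑ n (λ k → x R.^ k R.* R.1/! k) m)
      (trans (sum-cong (λ k → cong (_* invFact k) (seq-^ x k m)) n) (sym (E-def n (seq x m))))

  Li₂⇒Li : ∀ x y → Li₂ x y → ∀ η → 0ℚ < η →
    Eventually (λ n → Eventually (λ m → ∣ Li n (seq x m) - seq y m ∣ ≤ η))
  Li₂⇒Li x y e η η>0 = mapᵉ
    (λ n → mapᵉ (λ m → subst (λ u → ∣ u - seq y m ∣ ≤ η) (partial n m)))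
    (⟶⇒termwise (λ n → ∑< n (λ k → x R.^ suc k R.* (1/suc k) R.^ 2)) y e η η>0)
    where
    partial : ∀ n m → seq (∑< n (λ k → x R.^ suc k R.* (1/suc k) R.^ 2)) m ≡ Li n (seq x m)
    partial n m = trans (seq-∑ n (λ k → x R.^ suc k R.* (1/suc k) R.^ 2) m)
      (trans (sum-cong (λ k → cong (_* weight k) (seq-^ x (suc k) m)) n) (sym (Li-def n (seq x m))))

  -- Logarithms

  1≰0 : 1ℚ ≤ 0ℚ → ⊥
  1≰0 (*≤* (ℤ.+≤+ ()))

  -- For x ≤ 0 the polynomial is at most 2, so y would be at most 3.
  E-large⇒nonNeg : ∀ k x y → ∣ E (suc (suc (k ℕ.+ k))) x - y ∣ ≤ 1ℚ → ⟦ 4 ⟧ ≤ y → 0ℚ ≤ x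
  E-large⇒nonNeg k x y h y≥4 with ≤-total 0ℚ x
  ... | inj₁ x≥0 = x≥0
  ... | inj₂ x≤0 = ⊥-elim (1≰0 (≤-by (gap (∣p∣≤⇒-p≤ h) ⊕ gap y≥4 ⊕ gap E≤2) (lem₂ e y)))
    where
    e : ℚ
    e = E (suc (suc (k ℕ.+ k))) x
    lem₁ : ∀ x → - - x ≡ x
    lem₁ = solve 1 (λ x → :- (:- x) := x) refl
    lem₂ : ∀ e y → 0ℚ ≡ 1ℚ + ((1ℚ - - (e - y)) + (y - (ℤ.+ 4 / 1)) + ((ℤ.+ 2 / 1) - e))
    lem₂ = solve 2 (λ e y →
      con 0ℚ := con 1ℚ :+ (con 1ℚ :- (:- (e :- y)) :+ (y :- con (ℤ.+ 4 / 1)) :+ (con (ℤ.+ 2 / 1)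
        :- e))) refl
    E≤2 : e ≤ ⟦ 2 ⟧
    E≤2 = subst (λ z → E (suc (suc (k ℕ.+ k))) z ≤ ⟦ 2 ⟧) (lem₁ x) (E-neg k (neg-antimono-≤ x≤0))

  log-nonNeg : ∀ x y → Exp x y → Eventually (λ m → ⟦ 4 ⟧ ≤ seq y m) →
    Eventually (λ m → 0ℚ ≤ seq x m)
  log-nonNeg x y e y≥4 = mapᵉ (λ m (h , k) → E-large⇒nonNeg N (seq x m) (seq y m) h k)
      -- An even number of terms beyond the threshold, as `E-neg` requires.
      (proj₂ sums (suc (suc (N ℕ.+ N))) (ℕ.m≤n⇒m≤1+n (ℕ.m≤n⇒m≤1+n (ℕ.m≤m+n N N))) & y≥4)
    where
    sums = Exp⇒E x y e 1ℚ (positive⁻¹ 1ℚ)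
    N : ℕ
    N = proj₁ sums

  E-close⇒≤ : ∀ n {x x′ y η} → 0ℚ ≤ η → 0ℚ ≤ x → 0ℚ ≤ x′ →
    ∣ E (suc n) x - y ∣ ≤ ½ * η → ∣ E (suc (suc n)) x′ - y ∣ ≤ ½ * η → x′ ≤ x + η
  E-close⇒≤ n {x} {x′} {y} {η} η≥0 x≥0 x′≥0 h h′ = E-separates n x≥0 x′≥0 η≥0
    (≤-by (gap (∣p∣≤⇒-p≤ h) ⊕ gap (∣p∣≤⇒p≤ h′)) (lem (E (suc n) x) (E (suc (suc n)) x′) y η))
    where
    lem : ∀ u v y η → u + η ≡ v + ((½ * η - - (u - y)) + (½ * η - (v - y)))
    lem = solve 4 (λ u v y η →
      u :+ η := v :+ (con ½ :* η :- (:- (u :- y)) :+ (con ½ :* η :- (v :- y)))) refl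

  log-≤ : ∀ x x′ y → Exp x y → Exp x′ y → Eventually (λ m → ⟦ 4 ⟧ ≤ seq y m) →
    ∀ η → 0ℚ < η → Eventually (λ m → seq x′ m ≤ seq x m + η)
  log-≤ x x′ y e e′ y≥4 η η>0 = mapᵉ
      (λ m (h , h′ , x≥0 , x′≥0) → E-close⇒≤ (N ℕ.+ N′) {seq x m} {seq x′ m} {seq y m}
        (<⇒≤ η>0) x≥0 x′≥0 h h′)
      -- `E-separates` compares with one more term on the side of `x′`; both counts lie beyond both
      -- thresholds.
      (proj₂ sums (suc (N ℕ.+ N′)) (ℕ.m≤n⇒m≤1+n (ℕ.m≤m+n N N′))
        & proj₂ sums′ (suc (suc (N ℕ.+ N′))) (ℕ.m≤n⇒m≤1+n (ℕ.m≤n⇒m≤1+n (ℕ.m≤n+m N′ N)))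
        & log-nonNeg x y e y≥4 & log-nonNeg x′ y e′ y≥4)
    where
    sums = Exp⇒E x y e (½ * η) (½*-pos η>0)
    sums′ = Exp⇒E x′ y e′ (½ * η) (½*-pos η>0)
    N N′ : ℕ
    N = proj₁ sums
    N′ = proj₁ sums′

  log-unique : ∀ x x′ y → Exp x y → Exp x′ y → Eventually (λ m → ⟦ 4 ⟧ ≤ seq y m) →
    ∀ η → 0ℚ < η → Eventually (λ m → ∣ seq x m - seq x′ m ∣ ≤ η)
  log-unique x x′ y e e′ y≥4 η η>0 = mapᵉ
    (λ m (h , h′) → ∣∣≤-intro (≤-by (gap h′) (lem₁ (seq x m) (seq x′ m) η))
                               (≤-by (gap h) (lem₂ (seq x m) (seq x′ m) η)))
    (log-≤ x x′ y e e′ y≥4 η η>0 & log-≤ x′ x y e′ e y≥4 η η>0)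
    where
    lem₁ : ∀ x x′ η → η ≡ (x - x′) + ((x′ + η) - x)
    lem₁ = solve 3 (λ x x′ η → η := x :- x′ :+ (x′ :+ η :- x)) refl
    lem₂ : ∀ x x′ η → η ≡ - (x - x′) + ((x + η) - x′)
    lem₂ = solve 3 (λ x x′ η → η := :- (x :- x′) :+ (x :+ η :- x′)) refl

  -- With C = c + 1 ≥ 8 the error 1 is absorbed: 4E ≥ 4y - 4 ≥ 2C - 4 ≥ C and E ≤ y + 1 ≤ 4C + 1 ≤
  -- 5C. These are the hypotheses of `H-4≤` and `≤H+4`.
  E-near⇒H : ∀ c j {x y} → ⟦ 8 ⟧ ≤ ⟦ suc c ⟧ → ∣ E (suc (suc c ℕ.+ suc j)) x - y ∣ ≤ 1ℚ →
    0ℚ ≤ x → ⟦ suc c ⟧ ≤ ⟦ 2 ⟧ * y → y ≤ ⟦ 4 ⟧ * ⟦ suc c ⟧ → ∣ x - H (suc c) ∣ ≤ ⟦ 4 ⟧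
  E-near⇒H c j {x} {y} 8≤c h x≥0 lo hi = ∣∣≤-intro
    (≤-by (gap (≤H+4 c j x≥0 E≤5c)) (lem₃ x (H (suc c)) ⟦ 4 ⟧))
    (≤-by (gap (H-4≤ c (suc c ℕ.+ suc j) x≥0 c≤4E)) (lem₄ x (H (suc c)) ⟦ 4 ⟧))
    where
    e C : ℚ
    e = E (suc (suc c ℕ.+ suc j)) x
    C = ⟦ suc c ⟧
    lem₁ : ∀ c e y → (ℤ.+ 4 / 1) * e ≡ c + ((ℤ.+ 4 / 1) * (1ℚ - - (e - y))
      + (ℤ.+ 2 / 1) * ((ℤ.+ 2 / 1) * y - c) + (c - (ℤ.+ 8 / 1)) + (ℤ.+ 4 / 1))
    lem₁ = solve 3 (λ c e y →
      con (ℤ.+ 4 / 1) :* e := c :+ (con (ℤ.+ 4 / 1) :* (con 1ℚ :- (:- (e :- y)))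
        :+ con (ℤ.+ 2 / 1) :* (con (ℤ.+ 2 / 1) :* y :- c) :+ (c :- con (ℤ.+ 8 / 1))
        :+ con (ℤ.+ 4 / 1))) refl
    lem₂ : ∀ c e y → (ℤ.+ 5 / 1) * c ≡ e + ((1ℚ - (e - y))
      + ((ℤ.+ 4 / 1) * c - y) + (c - (ℤ.+ 8 / 1)) + (ℤ.+ 7 / 1))
    lem₂ = solve 3 (λ c e y →
      con (ℤ.+ 5 / 1) :* c := e :+ (con 1ℚ :- (e :- y) :+ (con (ℤ.+ 4 / 1) :* c :- y) :+ (c
        :- con (ℤ.+ 8 / 1)) :+ con (ℤ.+ 7 / 1))) refl
    lem₃ : ∀ x h f → f ≡ (x - h) + ((h + f) - x)
    lem₃ = solve 3 (λ x h f → f := x :- h :+ (h :+ f :- x)) refl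
    lem₄ : ∀ x h f → f ≡ - (x - h) + (x - (h - f))
    lem₄ = solve 3 (λ x h f → f := :- (x :- h) :+ (x :- (h :- f))) refl
    c≤4E : C ≤ ⟦ 4 ⟧ * e
    c≤4E = ≤-by (0≤⟦⟧ 4 ⊗ gap (∣p∣≤⇒-p≤ h) ⊕ 0≤⟦⟧ 2 ⊗ gap lo ⊕ gap 8≤c ⊕ 0≤⟦⟧ 4) (lem₁ C e y)
    E≤5c : e ≤ ⟦ 5 ⟧ * C
    E≤5c = ≤-by (gap (∣p∣≤⇒p≤ h) ⊕ gap hi ⊕ gap 8≤c ⊕ 0≤⟦⟧ 7) (lem₂ C e y)

  log-H : ∀ c x y → Exp x y → ⟦ 8 ⟧ ≤ ⟦ suc c ⟧ →
    Eventually (λ m → ⟦ suc c ⟧ ≤ ⟦ 2 ⟧ * seq y m × seq y m ≤ ⟦ 4 ⟧ * ⟦ suc c ⟧) →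
    Eventually (λ m → ∣ seq x m - H (suc c) ∣ ≤ ⟦ 4 ⟧)
  log-H c x y e 8≤c bd = mapᵉ
      (λ m (h , x≥0 , (lo , hi)) → E-near⇒H c N {seq x m} {seq y m} 8≤c h x≥0 lo hi)
      (proj₂ sums (suc (suc c ℕ.+ suc N))
          (ℕ.m≤n⇒m≤1+n (ℕ.≤-trans (ℕ.n≤1+n N) (ℕ.m≤n+m (suc N) (suc c))))
        & log-nonNeg x y e (mapᵉ (λ m (lo , _) → y≥4 (seq y m) lo) bd) & bd)
    where
    sums = Exp⇒E x y e 1ℚ (positive⁻¹ 1ℚ)
    N : ℕ
    N = proj₁ sums
    lem : ∀ c y → y ≡ (ℤ.+ 4 / 1) + ½ * (((ℤ.+ 2 / 1) * y - c) + (c - (ℤ.+ 8 / 1)))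
    lem = solve 2 (λ c y →
      y := con (ℤ.+ 4 / 1) :+ con ½ :* (con (ℤ.+ 2 / 1) :* y :- c :+ (c :- con (ℤ.+ 8 / 1)))) refl
    y≥4 : ∀ y → ⟦ suc c ⟧ ≤ ⟦ 2 ⟧ * y → ⟦ 4 ⟧ ≤ y
    y≥4 y lo = ≤-by (<⇒≤ 0<½ ⊗ (gap lo ⊕ gap 8≤c)) (lem ⟦ suc c ⟧ y)

  -- The cutoff

  opaque
    -- Start from M ≥ 1/e and decrease while 2Me ≥ 1 persists. When 2Me ≤ 1 is met, (M + 1)e ≤ ½ + e
    -- ≤ 1.
    cutoff-ℚ : ∀ {e} → 0ℚ < e → e ≤ ½ → ∃[ c ] (1ℚ ≤ ⟦ 2 ⟧ * (⟦ suc c ⟧ * e) × ⟦ suc c ⟧ * e ≤ 1ℚ)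
    cutoff-ℚ {e} e>0 e≤½ with archimedean ((1/ e) {{>-nonZero e>0}})
    ... | M , M≥ = search M (begin
        1ℚ                        ≡⟨ sym (*-inverseˡ e {{>-nonZero e>0}}) ⟩
        (1/ e) {{>-nonZero e>0}} * e
          ≤⟨ *-monoʳ-≤-nonNeg e {{nonNegative (<⇒≤ e>0)}} M≥ ⟩
        ⟦ M ⟧ * e
          ≤⟨ ≤-by (0≤⟦⟧ M ⊗ <⇒≤ e>0) (lem₀ (⟦ M ⟧ * e)) ⟩
        ⟦ 2 ⟧ * (⟦ M ⟧ * e)       ∎)
      where
      open ≤-Reasoning
      lem₀ : ∀ t → (ℤ.+ 2 / 1) * t ≡ t + t
      lem₀ = solve 1 (λ t → con (ℤ.+ 2 / 1) :* t := t :+ t) refl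
      lem₁ : ∀ e → (ℤ.+ 2 / 1) * (0ℚ * e) ≡ 0ℚ
      lem₁ = solve 1 (λ e → con (ℤ.+ 2 / 1) :* (con 0ℚ :* e) := con 0ℚ) refl
      lem₂ : ∀ c e → 1ℚ ≡ (1ℚ + c) * e + (½ * (1ℚ - (ℤ.+ 2 / 1) * (c * e)) + (½ - e))
      lem₂ = solve 2 (λ c e →
        con 1ℚ := (con 1ℚ :+ c) :* e :+ (con ½ :* (con 1ℚ :- con (ℤ.+ 2 / 1) :* (c :* e))
          :+ (con ½ :- e))) refl
      search : ∀ M → 1ℚ ≤ ⟦ 2 ⟧ * (⟦ M ⟧ * e) →
        ∃[ c ] (1ℚ ≤ ⟦ 2 ⟧ * (⟦ suc c ⟧ * e) × ⟦ suc c ⟧ * e ≤ 1ℚ)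
      search zero    h = ⊥-elim (1≰0 (≤-trans h (≤-reflexive (lem₁ e))))
      search (suc M) h with ≤-total 1ℚ (⟦ 2 ⟧ * (⟦ M ⟧ * e))
      ... | inj₁ h′ = search M h′
      ... | inj₂ h′ = M , h , subst (λ c → c * e ≤ 1ℚ) (sym (⟦⟧-suc M))
        (≤-by (<⇒≤ 0<½ ⊗ gap h′ ⊕ gap e≤½) (lem₂ ⟦ M ⟧ e))

  -- Together with 1 ≤ 2Ce it forces C ≥ 16, more than the 8 that `E-near⇒H` asks for.
  δ₀ : ℚ
  δ₀ = ℤ.+ 1 / 32

  0<δ₀ : 0ᴿ R.< fromℚ δ₀
  0<δ₀ = δ₀ , positive⁻¹ δ₀ , 0 , λ _ _ → ≤-reflexive (+-identityˡ δ₀)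

  -- `suc c` is comparable to 1/e. The constants are twice those of `cutoff-ℚ`, so that the
  -- condition survives a small relative change of `e`.
  Scale : ℕ → ℚ → Set
  Scale c e = 0ℚ ≤ e × e ≤ 1ℚ × 1ℚ ≤ ⟦ 4 ⟧ * (⟦ suc c ⟧ * e) × ⟦ suc c ⟧ * e ≤ ⟦ 2 ⟧

  -- As `recip 3` is 1/4 and d ≤ e, x lies between 3e/4 and 5e/4.
  Scale-near : ∀ c {d e x} → 0ℚ ≤ d → d ≤ e → 1ℚ ≤ ⟦ 2 ⟧ * (⟦ suc c ⟧ * e) → ⟦ suc c ⟧ * e ≤ 1ℚ →
    ∣ x - e ∣ ≤ recip 3 * d → d ≤ x → x ≤ δ₀ → Scale c x
  Scale-near c {d} {e} {x} d≥0 d≤e 1≤2Ce Ce≤1 h l u =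
      ≤-trans d≥0 l
    , ≤-trans u (≤ᵇ⇒≤ _)
    , ≤-by (0≤⟦⟧ 4 ⊗ 0≤⟦⟧ (suc c) ⊗ gap (∣p∣≤⇒-p≤ h) ⊕ 0≤⟦⟧ 2 ⊗ gap 1≤2Ce
        ⊕ gap Ce≤1 ⊕ 0≤⟦⟧ (suc c) ⊗ gap d≤e) (lem₂ ⟦ suc c ⟧ e d x)
    , ≤-by (0≤⟦⟧ (suc c) ⊗ gap (∣p∣≤⇒p≤ h) ⊕ gap Ce≤1
        ⊕ 0≤recip 3 ⊗ (gap Ce≤1 ⊕ 0≤⟦⟧ (suc c) ⊗ gap d≤e) ⊕ 0≤3/4) (lem₃ ⟦ suc c ⟧ e d x)
    where
    0≤3/4 : 0ℚ ≤ ℤ.+ 3 / 4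
    0≤3/4 = ≤ᵇ⇒≤ _
    lem₂ : ∀ c e d x → (ℤ.+ 4 / 1) * (c * x) ≡ 1ℚ +
      ((ℤ.+ 4 / 1) * c * ((ℤ.+ 1 / 4) * d - - (x - e)) + (ℤ.+ 2 / 1) * ((ℤ.+ 2 / 1) * (c * e) - 1ℚ)
        + (1ℚ - c * e) + c * (e - d))
    lem₂ = solve 4 (λ c e d x →
      con (ℤ.+ 4 / 1) :* (c :* x) := con 1ℚ :+ (con (ℤ.+ 4 / 1) :* c :* (con (ℤ.+ 1 / 4) :* d
        :- (:- (x :- e))) :+ con (ℤ.+ 2 / 1) :* (con (ℤ.+ 2 / 1) :* (c :* e) :- con 1ℚ) :+ (con 1ℚ
        :- c :* e) :+ c :* (e :- d))) refl
    lem₃ : ∀ c e d x → (ℤ.+ 2 / 1) ≡ c * x +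
      (c * ((ℤ.+ 1 / 4) * d - (x - e)) + (1ℚ - c * e) + (ℤ.+ 1 / 4) * ((1ℚ - c * e) + c * (e - d))
        + (ℤ.+ 3 / 4))
    lem₃ = solve 4 (λ c e d x →
      con (ℤ.+ 2 / 1) := c :* x :+ (c :* (con (ℤ.+ 1 / 4) :* d :- (x :- e)) :+ (con 1ℚ :- c :* e)
        :+ con (ℤ.+ 1 / 4) :* (con 1ℚ :- c :* e :+ c :* (e :- d)) :+ con (ℤ.+ 3 / 4))) refl

  8≤cutoff : ∀ c {e} → e ≤ δ₀ → 1ℚ ≤ ⟦ 2 ⟧ * (⟦ suc c ⟧ * e) → ⟦ 8 ⟧ ≤ ⟦ suc c ⟧
  8≤cutoff c {e} e≤δ₀ 1≤2Ce = ≤-by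
    (0≤⟦⟧ 16 ⊗ gap 1≤2Ce ⊕ 0≤⟦⟧ 32 ⊗ 0≤⟦⟧ (suc c) ⊗ gap e≤δ₀ ⊕ 0≤⟦⟧ 8) (lem ⟦ suc c ⟧ e)
    where
    lem : ∀ c e → c ≡ (ℤ.+ 8 / 1) + ((ℤ.+ 16 / 1) * ((ℤ.+ 2 / 1) * (c * e) - 1ℚ)
      + (ℤ.+ 32 / 1) * c * ((ℤ.+ 1 / 32) - e) + (ℤ.+ 8 / 1))
    lem = solve 2 (λ c e →
      c := con (ℤ.+ 8 / 1) :+ (con (ℤ.+ 16 / 1) :* (con (ℤ.+ 2 / 1) :* (c :* e) :- con 1ℚ)
        :+ con (ℤ.+ 32 / 1) :* c :* (con (ℤ.+ 1 / 32) :- e) :+ con (ℤ.+ 8 / 1))) refl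

  cutoff : ∀ ε → 0ᴿ R.< ε → ε R.< fromℚ δ₀ →
    ∃[ c ] (⟦ 8 ⟧ ≤ ⟦ suc c ⟧ × Eventually (λ m → Scale c (seq ε m)))
  cutoff ε (d , d>0 , N , lo) (d′ , d′>0 , N′ , hi) = c , 8≤cutoff c e≤δ₀ 1≤2Ce ,
    mapᵉ (λ m (h , l , u) → Scale-near c (<⇒≤ d>0) d≤e 1≤2Ce Ce≤1 h l u)
      ((M , λ m M≤m → proj₂ near m i M≤m M≤i) & (N , low) & (N′ , high))
    where
    near = cauchy ε (recip 3 * d) (*-pos (positive⁻¹ (recip 3)) d>0)
    M i : ℕ
    M = proj₁ near
    -- One index beyond all three thresholds; the cutoff is chosen from this single approximation of
    -- `ε`.
    i = N ℕ.+ (N′ ℕ.+ M)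
    M≤i : M ℕ.≤ i
    M≤i = ℕ.≤-trans (ℕ.m≤n+m M N′) (ℕ.m≤n+m (N′ ℕ.+ M) N)
    low : ∀ m → N ℕ.≤ m → d ≤ seq ε m
    low m N≤m = subst (_≤ seq ε m) (+-identityˡ d) (lo m N≤m)
    high : ∀ m → N′ ℕ.≤ m → seq ε m ≤ δ₀
    high m N′≤m = ≤-trans (≤-by (<⇒≤ d′>0) refl) (hi m N′≤m)
    e : ℚ
    e = seq ε i
    d≤e : d ≤ e
    d≤e = low i (ℕ.m≤m+n N (N′ ℕ.+ M))
    e≤δ₀ : e ≤ δ₀
    e≤δ₀ = high i (ℕ.≤-trans (ℕ.m≤m+n N′ M) (ℕ.m≤n+m (N′ ℕ.+ M) N))
    cut : ∃[ c ] (1ℚ ≤ ⟦ 2 ⟧ * (⟦ suc c ⟧ * e) × ⟦ suc c ⟧ * e ≤ 1ℚ)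
    cut = cutoff-ℚ {e} (<-≤-trans d>0 d≤e) (≤-trans e≤δ₀ (≤ᵇ⇒≤ _))
    c : ℕ
    c = proj₁ cut
    1≤2Ce : 1ℚ ≤ ⟦ 2 ⟧ * (⟦ suc c ⟧ * e)
    1≤2Ce = proj₁ (proj₂ cut)
    Ce≤1 : ⟦ suc c ⟧ * e ≤ 1ℚ
    Ce≤1 = proj₂ (proj₂ cut)

  inv-scale : ∀ c ε (ε>0 : 0ᴿ R.< ε) → Eventually (λ m → Scale c (seq ε m)) →
    Eventually (λ m → ⟦ suc c ⟧ ≤ ⟦ 2 ⟧ * seq (inv ε ε>0) m × seq (inv ε ε>0) m ≤ ⟦ 4 ⟧ * ⟦ suc c ⟧)
  inv-scale c ε ε>0@(d , d>0 , N , lo) (M , sc) = M , λ m M≤m →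
    -- `inv` reads `ε` at the index shifted by the `N` in the proof of positivity.
    let e>0 = <-≤-trans d>0 (subst (_≤ seq ε (N ℕ.+ m)) (+-identityˡ d) (lo (N ℕ.+ m) (ℕ.m≤m+n N m)))
    in step (seq ε (N ℕ.+ m)) (seq (inv ε ε>0) m) e>0
         (*-inverseʳ (seq ε (N ℕ.+ m)) {{>-nonZero e>0}})
         (sc (N ℕ.+ m) (ℕ.≤-trans M≤m (ℕ.m≤n+m m N)))
    where
    lem₁ : ∀ c e y → (ℤ.+ 2 / 1) * y ≡ c * (e * y) + ((ℤ.+ 2 / 1) - c * e) * y
    lem₁ = solve 3 (λ c e y →
      con (ℤ.+ 2 / 1) :* y := c :* (e :* y) :+ (con (ℤ.+ 2 / 1) :- c :* e) :* y) refl
    lem₂ : ∀ c e y → (ℤ.+ 4 / 1) * (c * (e * y)) ≡ y + ((ℤ.+ 4 / 1) * (c * e) - 1ℚ) * y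
    lem₂ = solve 3 (λ c e y →
      con (ℤ.+ 4 / 1) :* (c :* (e :* y)) := y :+ (con (ℤ.+ 4 / 1) :* (c :* e)
        :- con 1ℚ) :* y) refl
    step : ∀ e y → 0ℚ < e → e * y ≡ 1ℚ → Scale c e → ⟦ suc c ⟧ ≤ ⟦ 2 ⟧ * y × y ≤ ⟦ 4 ⟧ * ⟦ suc c ⟧
    step e y e>0 ey (_ , _ , lo , hi) =
        ≤-by (gap hi ⊗ y≥0) (trans (lem₁ C e y) (cong (_+ (⟦ 2 ⟧ - C * e) * y) Cey))
      , ≤-by (gap lo ⊗ y≥0) (trans (cong (⟦ 4 ⟧ *_) (sym Cey)) (lem₂ C e y))
      where
      C : ℚ
      C = ⟦ suc c ⟧
      Cey : C * (e * y) ≡ C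
      Cey = trans (cong (C *_) ey) (*-identityʳ C)
      y≥0 : 0ℚ ≤ y
      y≥0 = *-nonNeg-cancel e>0 (subst (0ℚ ≤_) (sym ey) 0≤1)

  -- The difference of the terms of the series for 𝒵₂ at 1 − e and at 1, where q = 1/n and
  -- b, a stand for Li₂((1 − e)q), Li₂(q).
  change : ℚ → ℚ → ℚ → ℚ → ℚ
  change e q b a = (b - (1ℚ - e) * q) - (a - q)

  change-LiDrop : ∀ n e q b a {η} → ∣ Li n ((1ℚ - e) * q) - b ∣ ≤ ½ * η → ∣ Li n q - a ∣ ≤ ½ * η →
    ∣ change e q b a + (LiDrop n e q - e * q) ∣ ≤ η
  change-LiDrop n e q b a {η} hb ha = subst₂ (λ u v → ∣ u ∣ ≤ v)
    (trans (lem (Li n ((1ℚ - e) * q)) (Li n q) b a e q)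
      (cong (λ d → change e q b a + (d - e * q)) (Li-LiDrop n e q)))
    (½+½ η)
    (∣∣≤-+ {p = - (Li n ((1ℚ - e) * q) - b)} {q = Li n q - a} (∣∣≤-neg hb) ha)
    where
    lem : ∀ l′ l b a e q → - (l′ - b) + (l - a) ≡ ((b - (1ℚ - e) * q) - (a - q)) + ((l - l′) - e * q)
    lem = solve 6 (λ l′ l b a e q →
      :- (l′ :- b) :+ (l :- a) := b :- (con 1ℚ :- e) :* q :- (a :- q) :+ (l :- l′ :- e :* q)) refl

  -- The constant is 9 = 4 + 4 + 1: cutting the dilogarithm sum, replacing `H` by `L`, and the
  -- linear term. It is written as 10 - 1 to start the telescoping sum over n.
  change-first : ∀ c j {e L b a η} → Scale c e → ∣ L - H (suc c) ∣ ≤ ⟦ 4 ⟧ →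
    ∣ Li (j ℕ.+ suc c) ((1ℚ - e) * recip 0) - b ∣ ≤ ½ * η →
    ∣ Li (j ℕ.+ suc c) (recip 0) - a ∣ ≤ ½ * η →
    ∣ change e (recip 0) b a + e * L ∣ ≤ e * (⟦ 10 ⟧ - recip 0) + η
  change-first c j {e} {L} {b} {a} {η} (e≥0 , e≤1 , 1≤4Ce , Ce≤2) hL hb ha =
    subst₂ (λ u v → ∣ u ∣ ≤ v)
      (lem₁ (change e (recip 0) b a) d e L (H (suc c))) (lem₂ e η)
      (∣∣≤-+ (∣∣≤-+ (∣∣≤-+ near (∣∣≤-neg (∣LiDrop-one-eH∣≤ e≥0 e≤1 c j 1≤4Ce Ce≤2))) (∣∣≤-* ∣e∣≤ hL)) ∣e∣≤)
    where
    d : ℚ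
    d = LiDrop (j ℕ.+ suc c) e (recip 0)
    ∣e∣≤ : ∣ e ∣ ≤ e
    ∣e∣≤ = ≤-reflexive (0≤p⇒∣p∣≡p e≥0)
    near : ∣ change e (recip 0) b a + (d - e * recip 0) ∣ ≤ η
    near = change-LiDrop (j ℕ.+ suc c) e (recip 0) b a {η} hb ha
    lem₁ : ∀ t d e L h → ((t + (d - e * 1ℚ)) + - (d - e * h)) + e * (L - h) + e ≡ t + e * L
    lem₁ = solve 5 (λ t d e L h →
      t :+ (d :- e :* con 1ℚ) :+ (:- (d :- e :* h)) :+ e :* (L :- h) :+ e := t :+ e :* L) refl
    lem₂ : ∀ e η → ((η + (ℤ.+ 4 / 1) * e) + e * (ℤ.+ 4 / 1)) + e ≡ e * ((ℤ.+ 10 / 1) - 1ℚ) + η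
    lem₂ = solve 2 (λ e η →
      η :+ con (ℤ.+ 4 / 1) :* e :+ e :* con (ℤ.+ 4 / 1) :+ e := e :* (con (ℤ.+ 10 / 1) :- con 1ℚ)
        :+ η) refl

  change-rest : ∀ i j {e b a η} → 0ℚ ≤ e → e ≤ 1ℚ →
    ∣ Li (suc j) ((1ℚ - e) * recip (suc i)) - b ∣ ≤ ½ * η → ∣ Li (suc j) (recip (suc i)) - a ∣ ≤ ½ * η →
    ∣ change e (recip (suc i)) b a ∣ ≤ η + e * (recip i - recip (suc i))
  change-rest i j {e} {b} {a} {η} e≥0 e≤1 hb ha =
    subst (λ u → ∣ u ∣ ≤ η + e * (recip i - q)) (lem (change e q b a) d)
      (∣∣≤-+ {p = change e q b a + d} { - d} (change-LiDrop (suc j) e q b a {η} hb ha)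
        (∣∣≤-neg {d} (∣LiDrop-recip-eq∣≤ e≥0 e≤1 i j)))
    where
    q d : ℚ
    q = recip (suc i)
    d = LiDrop (suc j) e q - e * q
    lem : ∀ t d → (t + d) + - d ≡ t
    lem = solve 2 (λ t d → t :+ d :+ (:- d) := t) refl

  -- Summation over n

  module _ (ε : ℝ) (c : ℕ) (scale : Eventually (λ m → Scale c (seq ε m)))
    (L : ℝ) (L≈H : Eventually (λ m → ∣ seq L m - H (suc c) ∣ ≤ ⟦ 4 ⟧))
    (a b : ℕ → ℝ) (a-Li : ∀ n → Li₂ (1/suc n) (a n))
    (b-Li : ∀ n → Li₂ ((1ᴿ R.- ε) R.* 1/suc n) (b n)) where

    private
      close : ∀ i η → 0ℚ < η → ∃[ N ] (∀ n → N ℕ.≤ n → Eventually (λ m →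
        ∣ Li n ((1ℚ - seq ε m) * recip i) - seq (b i) m ∣ ≤ ½ * η ×
        ∣ Li n (recip i) - seq (a i) m ∣ ≤ ½ * η))
      close i η η>0 = mapᵉ (λ n (p , q) → p & q)
        (Li₂⇒Li ((1ᴿ R.- ε) R.* 1/suc i) (b i) (b-Li i) (½ * η) (½*-pos η>0)
          & Li₂⇒Li (1/suc i) (a i) (a-Li i) (½ * η) (½*-pos η>0))

      first : ∀ η → 0ℚ < η → Eventually (λ m →
        ∣ change (seq ε m) (recip 0) (seq (b 0) m) (seq (a 0) m) + seq ε m * seq L m ∣
          ≤ seq ε m * (⟦ 10 ⟧ - recip 0) + η)
      first η η>0 = mapᵉ
        (λ m (sc , l , p , q) → change-first c N {seq ε m} {seq L m} {seq (b 0) m} {seq (a 0) m} {η} sc l p q)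
        (scale & L≈H & proj₂ (close 0 η η>0) (N ℕ.+ suc c) (ℕ.m≤m+n N (suc c)))
        where
        N : ℕ
        N = proj₁ (close 0 η η>0)

      rest : ∀ i η → 0ℚ < η → Eventually (λ m →
        ∣ change (seq ε m) (recip (suc i)) (seq (b (suc i)) m) (seq (a (suc i)) m) ∣
          ≤ η + seq ε m * (recip i - recip (suc i)))
      rest i η η>0 = mapᵉ
        (λ m ((e≥0 , e≤1 , _) , p , q) →
          change-rest i N {seq ε m} {seq (b (suc i)) m} {seq (a (suc i)) m} {η} e≥0 e≤1 p q)
        (scale & proj₂ (close (suc i) η η>0) (suc N) (ℕ.n≤1+n N))
        where
        N : ℕ
        N = proj₁ (close (suc i) η η>0)

    -- A sum of values of `change`, grouped into the partial sums that occur in 𝒵₂, in C₂ and in γ.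
    changes : ℕ → ℕ → ℚ
    changes n m = seq (∑< (suc n) (λ i → b i R.- (1ᴿ R.- ε) R.* 1/suc i)) m
      - (seq (∑< (suc n) a) m - seq (∑< (suc n) 1/suc_) m)

    -- The bound 10 - 1/(n + 1) grows by exactly what `change-rest` allows for the next term. It
    -- stays below 10 for all `n`, so `n` may later be taken large.
    ∣changes+εL∣≤ : ∀ n η → 0ℚ < η → Eventually (λ m →
      ∣ changes n m + seq ε m * seq L m ∣ ≤ seq ε m * (⟦ 10 ⟧ - recip n) + η)
    ∣changes+εL∣≤ zero η η>0 = mapᵉ
      (λ m → subst (λ t → ∣ t + seq ε m * seq L m ∣ ≤ seq ε m * (⟦ 10 ⟧ - recip 0) + η)
        (lem (seq (b 0) m) (seq (a 0) m) (recip 0) ((1ℚ - seq ε m) * recip 0)))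
      (first η η>0)
      where
      lem : ∀ b a q z → (b - z) - (a - q) ≡ (0ℚ + (b - z)) - ((0ℚ + a) - (0ℚ + q))
      lem = solve 4 (λ b a q z →
        b :- z :- (a :- q) := con 0ℚ :+ (b :- z) :- (con 0ℚ :+ a :- (con 0ℚ :+ q))) refl
    ∣changes+εL∣≤ (suc n) η η>0 = mapᵉ
      (λ m (h , k) → subst₂ (λ u v → ∣ u ∣ ≤ v)
        (lem₁ (seq (∑< (suc n) (λ i → b i R.- (1ᴿ R.- ε) R.* 1/suc i)) m) (seq (∑< (suc n) a) m)
          (seq (∑< (suc n) 1/suc_) m) (seq ε m * seq L m)
          (seq (b (suc n)) m) (seq (a (suc n)) m) (recip (suc n)) ((1ℚ - seq ε m) * recip (suc n)))
        (lem₂ (seq ε m) ⟦ 10 ⟧ (recip n) (recip (suc n)) η)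
        (∣∣≤-+ {p = changes n m + seq ε m * seq L m}
          {q = change (seq ε m) (recip (suc n)) (seq (b (suc n)) m) (seq (a (suc n)) m)} h k))
      (∣changes+εL∣≤ n (½ * η) (½*-pos η>0) & rest n (½ * η) (½*-pos η>0))
      where
      lem₁ : ∀ U A Q t b a q z → ((U - (A - Q)) + t) + ((b - z) - (a - q)) ≡
        ((U + (b - z)) - ((A + a) - (Q + q))) + t
      lem₁ = solve 8 (λ U A Q t b a q z →
        U :- (A :- Q) :+ t :+ (b :- z :- (a :- q)) := U :+ (b :- z) :- (A :+ a :- (Q :+ q))
          :+ t) refl
      lem₂ : ∀ e f r s η → (e * (f - r) + ½ * η) + (½ * η + e * (r - s)) ≡ e * (f - s) + η
      lem₂ = solve 5 (λ e f r s η →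
        e :* (f :- r) :+ con ½ :* η :+ (con ½ :* η :+ e :* (r :- s)) := e :* (f :- s) :+ η) refl

  -- `U`, `A`, `Q` are the partial sums for 𝒵₂, for the values of Li₂ and for the harmonic series;
  -- `l` and `l′` are the logarithms chosen in γ and in C₂. The quantity to be bounded is the signed
  -- sum of the five small ones, each contributing one `h`.
  assemble : ∀ {Z C γ U A Q l l′ e L r h} → 0ℚ ≤ e → 0ℚ ≤ r →
    ∣ U - Z ∣ ≤ h → ∣ (A - l′) - C ∣ ≤ h → ∣ (Q - l) - γ ∣ ≤ h → ∣ l′ - l ∣ ≤ h →
    ∣ (U - (A - Q)) + e * L ∣ ≤ e * (⟦ 10 ⟧ - r) + h →
    ∣ Z - (C - γ - e * L) ∣ ≤ ⟦ 10 ⟧ * e + ⟦ 5 ⟧ * h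
  assemble {Z} {C} {γ} {U} {A} {Q} {l} {l′} {e} {L} {r} {h} e≥0 r≥0 hU hA hQ hl ht = ≤-trans
    (subst (λ u → ∣ u ∣ ≤ ((((h + h) + h) + h) + (e * (⟦ 10 ⟧ - r) + h))) (lem₁ Z C γ U A Q l l′ (e * L))
      (∣∣≤-+ {p = ((- (U - Z) + ((A - l′) - C)) + - ((Q - l) - γ)) + (l′ - l)}
        (∣∣≤-+ {p = (- (U - Z) + ((A - l′) - C)) + - ((Q - l) - γ)}
          (∣∣≤-+ {p = - (U - Z) + ((A - l′) - C)}
            (∣∣≤-+ {p = - (U - Z)} {(A - l′) - C} (∣∣≤-neg {U - Z} hU) hA)
            (∣∣≤-neg {(Q - l) - γ} hQ)) hl) ht))
    (≤-by (e≥0 ⊗ r≥0) (lem₂ e r h))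
    where
    lem₁ : ∀ Z C γ U A Q l l′ t →
      (((- (U - Z) + ((A - l′) - C)) + - ((Q - l) - γ)) + (l′ - l)) + ((U - (A - Q)) + t)
        ≡ Z - (C - γ - t)
    lem₁ = solve 9 (λ Z C γ U A Q l l′ t →
      :- (U :- Z) :+ (A :- l′ :- C) :+ (:- (Q :- l :- γ)) :+ (l′ :- l) :+ (U :- (A :- Q) :+ t)
        := Z :- (C :- γ :- t)) refl
    lem₂ : ∀ e r h → (ℤ.+ 10 / 1) * e + (ℤ.+ 5 / 1) * h ≡
      ((((h + h) + h) + h) + (e * ((ℤ.+ 10 / 1) - r) + h)) + e * r
    lem₂ = solve 3 (λ e r h →
      con (ℤ.+ 10 / 1) :* e :+ con (ℤ.+ 5 / 1) :* h := h :+ h :+ h :+ h :+ (e :* (con (ℤ.+ 10 / 1)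
        :- r) :+ h) :+ e :* r) refl

  -- Passage to the limit

  module _ (γ C₂ ε Z L : ℝ) (ε>0 : 0ᴿ R.< ε) (l l′ a b : ℕ → ℝ)
    (l-log : ∀ n → Log (fromℕ (suc n)) (l n))
    (γ-limit : (λ n → ∑< (suc n) 1/suc_ R.- l n) ⟶ γ)
    (a-Li : ∀ n → Li₂ (1/suc n) (a n))
    (l′-log : ∀ n → Log (fromℕ (suc n)) (l′ n))
    (C₂-limit : (λ n → ∑< (suc n) a R.- l′ n) ⟶ C₂)
    (b-Li : ∀ n → Li₂ ((1ᴿ R.- ε) R.* 1/suc n) (b n))
    (Z-sum : HasSum (λ n → b n R.- (1ᴿ R.- ε) R.* 1/suc n) Z)
    (L-log : Log (inv ε ε>0) L)
    (c : ℕ) (8≤c : ⟦ 8 ⟧ ≤ ⟦ suc c ⟧) (scale : Eventually (λ m → Scale c (seq ε m))) where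

    private
      Z-terms : ℕ → ℝ
      Z-terms i = b i R.- (1ᴿ R.- ε) R.* 1/suc i

      -- From n = 3 on the argument n + 1 is at least 4, as `log-unique` needs; a limit ignores the
      -- smaller n.
      l′≈l : ∀ n → 3 ℕ.≤ n → ∀ η → 0ℚ < η → Eventually (λ m → ∣ seq (l′ n) m - seq (l n) m ∣ ≤ η)
      l′≈l n 3≤n = log-unique (l′ n) (l n) (fromℕ (suc n)) (l′-log n) (l-log n)
        (0 , λ _ _ → ⟦⟧-mono {4} {suc n} (ℕ.s≤s 3≤n))

      L≈H : Eventually (λ m → ∣ seq L m - H (suc c) ∣ ≤ ⟦ 4 ⟧)
      L≈H = log-H c L (inv ε ε>0) L-log 8≤c (inv-scale c ε ε>0 scale)

      estimate : ∀ h → 0ℚ < h → Eventually (λ m →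
        ∣ seq Z m - (seq C₂ m - seq γ m - seq ε m * seq L m) ∣ ≤ ⟦ 10 ⟧ * seq ε m + ⟦ 5 ⟧ * h)
      estimate h h>0 = mapᵉ
        (λ m (hU , hA , hQ , hl , ht , (e≥0 , _)) →
          assemble {seq Z m} {seq C₂ m} {seq γ m} {seq (∑< (suc n) Z-terms) m} {seq (∑< (suc n) a) m}
            {seq (∑< (suc n) 1/suc_) m} {seq (l n) m} {seq (l′ n) m} {seq ε m} {seq L m}
            e≥0 (0≤recip n) hU hA hQ hl ht)
        (proj₁ atN+1
          & proj₁ (proj₂ atN)
          & proj₂ (proj₂ atN)
          & l′≈l n (ℕ.m≤m+n 3 N) h h>0
          & ∣changes+εL∣≤ ε c scale L L≈H a b a-Li b-Li n h h>0
          & scale)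
        where
        limits : Eventually (λ n →
          Eventually (λ m → ∣ seq (∑< n Z-terms) m - seq Z m ∣ ≤ h) ×
          Eventually (λ m → ∣ (seq (∑< (suc n) a) m - seq (l′ n) m) - seq C₂ m ∣ ≤ h) ×
          Eventually (λ m → ∣ (seq (∑< (suc n) 1/suc_) m - seq (l n) m) - seq γ m ∣ ≤ h))
        limits = ⟶⇒termwise (λ n → ∑< n Z-terms) Z Z-sum h h>0
          & ⟶⇒termwise (λ n → ∑< (suc n) a R.- l′ n) C₂ C₂-limit h h>0
          & ⟶⇒termwise (λ n → ∑< (suc n) 1/suc_ R.- l n) γ γ-limit h h>0
        N n : ℕ
        N = proj₁ limits
        n = 3 ℕ.+ N
        N≤n : N ℕ.≤ n
        N≤n = ℕ.m≤n+m N 3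
        atN = proj₂ limits n N≤n
        -- The partial sums for `Z` are indexed without a shift, so n + 1 is the index that matches
        -- `∑< (suc n)` in the other two limits.
        atN+1 = proj₂ limits (suc n) (ℕ.m≤n⇒m≤1+n N≤n)

    𝒵₂-asymptotics : R.∣ Z R.- (C₂ R.- γ R.- ε R.* L) ∣ R.≤ fromℕ 10 R.* ε
    𝒵₂-asymptotics η η>0 = mapᵉ
      (λ m → subst (∣ seq Z m - (seq C₂ m - seq γ m - seq ε m * seq L m) ∣ ≤_)
        (cong (⟦ 10 ⟧ * seq ε m +_) (trans (sym (*-assoc ⟦ 5 ⟧ (recip 4) η))
          (trans (cong (_* η) (⟦⟧-recip 4)) (*-identityˡ η)))))
      -- `recip 4` is 1/5: the five errors `h` together make η.
      (estimate (recip 4 * η) (*-pos (positive⁻¹ (recip 4)) η>0))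

open import Defs

mainTheorem4 : ∀ (γ C₂ : ℝ) → EulerConstant γ → ConstantC₂ C₂ →
    ∃[ K ] ∃[ δ ] (0ᴿ < δ ×
    (∀ (ε : ℝ) (ε>0 : 0ᴿ < ε) → ε < δ →
    ∀ (Z L : ℝ) → 𝒵₂ (1ᴿ - ε) Z → Log (inv ε ε>0) L →
    ∣ Z - (C₂ - γ - ε * L) ∣ ≤ K * ε))
mainTheorem4 γ C₂ (l , l-log , γ-limit) (a , l′ , a-Li , l′-log , C₂-limit) =
  fromℕ 10 , fromℚ δ₀ , 0<δ₀ , λ ε ε>0 ε<δ₀ Z L (b , b-Li , Z-sum) L-log →
    let (c , 8≤c , scale) = cutoff ε ε>0 ε<δ₀
    in 𝒵₂-asymptotics γ C₂ ε Z L ε>0 l l′ a b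
         l-log γ-limit a-Li l′-log C₂-limit b-Li Z-sum L-log c 8≤c scale
  where
  open Estimates
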